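{- Let $j,k_G,k_H$ be positive integers with $j\le k_G\le k_H$, let $G$ be a $(j,k_G)$-biclique and $H$ a $(j,k_H)$-biclique, with $P_G(x)=(x)_{k_G}g(x)$ and $P_H(x)=(x)_{k_H}h(x)$. Let $c$ be an integer. Then $g(x)=(-1)^j h(-x+c)$ if and only if, for all $0\le i\le j$, $$m_{\bar G}^i=\sum_{l=0}^{i}(-1)^l\, m_{\bar H}^l\binom{j-l}{j-i}\,(k_G+k_H+j-c-l-1)_{i-l}.$$
   Context: All graphs are finite and simple. For integers $1\le j\le k$, a $(j,k)$-biclique is a graph whose vertex set is the disjoint union of a $j$-clique and a $k$-clique, with an arbitrary set of additional edges each joining a vertex of the $j$-clique to a vertex of the $k$-clique; $\bar G$ denotes the complement of $G$. $P_G(x)$ is the chromatic polynomial, and $(x)_n=x(x-1)\cdots(x-n+1)$ the falling factorial ($(x)_0=1$). For a $(j,k)$-biclique $G$, $(x)_k$ divides $P_G(x)$ and $g(x)=P_G(x)/(x)_k$ is a polynomial of degree $j$ (the interesting factor). $m_F^i$ denotes the number of matchings with $i$ edges in a graph $F$. -}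

module Defs where

open import Level using (0ℓ)
open import Data.Nat.Base as ℕ using (ℕ; zero; suc)
open import Data.Integer.Base as ℤ using (ℤ; +_; 0ℤ; 1ℤ; -1ℤ)
open import Data.Integer.Properties using (+-*-semiring)
open import Data.Fin.Base using (Fin; _<_)
open import Data.Fin.Properties using (_≟_; _<?_; all?)
open import Data.Fin.Subset using (Subset; _∈_; ∣_∣; ∁)
open import Data.List.Base using (List; []; _∷_; _++_; map; length; filter; allFin; cartesianProduct; cartesianProductWith)
open import Data.List.Relation.Unary.AllPairs using (AllPairs; allPairs?)
open import Data.Vec.Base using (Vec; []; _∷_; lookup)
open import Data.Product.Base using (_×_; _,_; proj₁; proj₂; ∃-syntax)
open import Relation.Binary.Core using (Rel)
open import Relation.Binary.Definitions using (Decidable; Symmetric; Irreflexive)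
open import Relation.Binary.PropositionalEquality using (_≡_; _≢_; ≢-sym)
open import Relation.Nullary.Decidable using (Dec; ¬?; _×-dec_; _→-dec_)
open import Relation.Nullary.Negation using (¬_)

open import Algebra.Properties.Semiring.Sum +-*-semiring public
  using (sum; sum-syntax; sum⁺-syntax)

record Graph (n : ℕ) : Set₁ where
  field
    Adj    : Rel (Fin n) 0ℓ
    adj?   : Decidable Adj
    symm   : Symmetric Adj
    irrefl : Irreflexive _≡_ Adj

open Graph public

complement : ∀ {n} → Graph n → Graph n
complement G .Adj u v                 = u ≢ v × ¬ Adj G u v
complement G .adj? u v                = ¬? (u ≟ v) ×-dec ¬? (adj? G u v)
complement G .symm (u≢v , ¬uv)        = ≢-sym u≢v , λ vu → ¬uv (symm G vu)
complement G .irrefl u≡v (u≢v , _)    = u≢v u≡v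

IsClique : ∀ {n} → Graph n → Subset n → Set
IsClique G S = ∀ u v → u ∈ S → v ∈ S → u ≢ v → Adj G u v

IsBiclique : ∀ {n} → ℕ → ℕ → Graph n → Set
IsBiclique {n} j k G =
  ∃[ S ] ∣ S ∣ ≡ j × ∣ ∁ {n} S ∣ ≡ k × IsClique G S × IsClique G (∁ S)

-- The edge {u , v} is the pair with u < v, so that each edge is listed once.
edges : ∀ {n} → Graph n → List (Fin n × Fin n)
edges {n} G =
  filter (λ e → (proj₁ e <? proj₂ e) ×-dec adj? G (proj₁ e) (proj₂ e))
         (cartesianProduct (allFin n) (allFin n))

DisjointEdges : ∀ {n} → Rel (Fin n × Fin n) 0ℓ
DisjointEdges (u , v) (u′ , v′) = u ≢ u′ × u ≢ v′ × v ≢ u′ × v ≢ v′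

disjointEdges? : ∀ {n} → Decidable (DisjointEdges {n})
disjointEdges? (u , v) (u′ , v′) =
  ¬? (u ≟ u′) ×-dec ¬? (u ≟ v′) ×-dec ¬? (v ≟ u′) ×-dec ¬? (v ≟ v′)

-- The i-element subsets of a duplicate-free list, each listed once, in the
-- order inherited from the list.
choose : ∀ {A : Set} → ℕ → List A → List (List A)
choose zero    xs       = [] ∷ []
choose (suc i) []       = []
choose (suc i) (x ∷ xs) = map (x ∷_) (choose i xs) ++ choose (suc i) xs

#matchings : ∀ {n} → Graph n → ℕ → ℕ
#matchings F i = length (filter (allPairs? disjointEdges?) (choose i (edges F)))

allColourings : ∀ n q → List (Vec (Fin q) n)
allColourings zero    q = [] ∷ []
allColourings (suc n) q = cartesianProductWith _∷_ (allFin q) (allColourings n q)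

IsProper : ∀ {n q} → Graph n → Vec (Fin q) n → Set
IsProper G c = ∀ u v → Adj G u v → lookup c u ≢ lookup c v

isProper? : ∀ {n q} (G : Graph n) (c : Vec (Fin q) n) → Dec (IsProper G c)
isProper? G c =
  all? λ u → all? λ v → adj? G u v →-dec ¬? (lookup c u ≟ lookup c v)

#properColourings : ∀ {n} → Graph n → ℕ → ℕ
#properColourings {n} G q = length (filter (isProper? G) (allColourings n q))

-- ℤ[x]: a₀ ∷ a₁ ∷ … ∷ [] is a₀ + a₁x + ….  Trailing zeros are allowed, so
-- equality of polynomials is _≈ₚ_, not _≡_.
Poly : Set
Poly = List ℤ

coeff : Poly → ℕ → ℤ
coeff []      _       = 0ℤ
coeff (a ∷ p) zero    = a
coeff (a ∷ p) (suc n) = coeff p n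

infix 4 _≈ₚ_
_≈ₚ_ : Rel Poly 0ℓ
p ≈ₚ q = ∀ n → coeff p n ≡ coeff q n

infixl 6 _+ₚ_
_+ₚ_ : Poly → Poly → Poly
[]      +ₚ q       = q
(a ∷ p) +ₚ []      = a ∷ p
(a ∷ p) +ₚ (b ∷ q) = (a ℤ.+ b) ∷ (p +ₚ q)

infixr 7 _·ₚ_
_·ₚ_ : ℤ → Poly → Poly
a ·ₚ p = map (a ℤ.*_) p

infixl 7 _*ₚ_
_*ₚ_ : Poly → Poly → Poly
[]      *ₚ q = []
(a ∷ p) *ₚ q = (a ·ₚ q) +ₚ (0ℤ ∷ (p *ₚ q))

infixr 9 _∘ₚ_
_∘ₚ_ : Poly → Poly → Poly
[]      ∘ₚ r = []
(a ∷ p) ∘ₚ r = (a ∷ []) +ₚ r *ₚ (p ∘ₚ r)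

eval : Poly → ℤ → ℤ
eval []      x = 0ℤ
eval (a ∷ p) x = a ℤ.+ x ℤ.* eval p x

-- (x)ₙ as a polynomial.
fallingₚ : ℕ → Poly
fallingₚ zero    = 1ℤ ∷ []
fallingₚ (suc n) = fallingₚ n *ₚ (ℤ.- (+ n) ∷ 1ℤ ∷ [])

-- (x)ₙ at an integer x.
falling : ℤ → ℕ → ℤ
falling x zero    = 1ℤ
falling x (suc n) = falling x n ℤ.* (x ℤ.- + n)

-X+_ : ℤ → Poly
-X+ c = c ∷ -1ℤ ∷ []

-- P_G is the unique polynomial whose value at each q ∈ ℕ is the number of
-- proper q-colourings of G.
IsChromaticPolynomial : ∀ {n} → Graph n → Poly → Set
IsChromaticPolynomial G P = ∀ q → eval P (+ q) ≡ + #properColourings G q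

{-# OPTIONS --safe #-}
-- In a biclique every colour class is a vertex or an edge of the complement, so
-- a proper colouring is a matching of the complement with distinct colours on
-- its classes.  Hence P_G(x) = Σ m^i (x)_{j+k-i}, and g(x) = Σ m^i (x-k)_{j-i}.
-- Since (-y)_n = (-1)^n (y+n-1)_n, Vandermonde's identity expands
-- (-1)^j h(-x+c) in the same basis (x-k_G)_{j-i}; the theorem compares
-- coefficients.
module Submission where

open import Defs
open import Algebra.Bundles using (AbelianGroup)
open import Data.Bool.Base using (Bool; true; false; _∧_; not; if_then_else_)
import Data.Bool.Properties as Bool
open import Data.Bool.Properties using (T?; ∧-comm; ∧-assoc)
open import Data.Empty using (⊥)
open import Data.Nat.Base as ℕ using (ℕ; zero; suc; _≤_; _∸_; z≤n; s≤s)
import Data.Nat.Properties as ℕ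
open import Data.Nat.Combinatorics using (_C_; nCk≡nC[n∸k]; nCk+nC[k+1]≡[n+1]C[k+1]; k>n⇒nCk≡0)
open import Data.Nat.Divisibility using (>⇒∤; m∣m*n) renaming (_∣_ to _∣ℕ_)
open import Data.Integer.Base as ℤ using (ℤ; +_; 0ℤ; 1ℤ; -1ℤ; _+_; _-_; -_; _*_; _^_; ≢-nonZero)
open import Data.Integer.Properties hiding (_≟_; _<?_)
open import Data.Integer.Tactic.RingSolver using (solve-∀)
open import Data.Fin.Base using (Fin; zero; suc; toℕ)
open import Data.Fin.Permutation using (reverse)
open import Data.Fin.Properties using (_≟_; _<?_; any?; all?; suc-injective; 0≢1+n; toℕ≤pred[n]; opposite-prop)
open import Data.Fin.Subset using (Subset; _∈_; ∣_∣; ⊤; ∁; inside; outside) renaming (_-_ to _─_)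
open import Data.Fin.Subset.Properties
  using (x∈p⇒∣p-x∣<∣p∣; x∈p∧x≢y⇒x∈p-y; ∣⊤∣≡n; ∈⊤; drop-there; _∈?_; x∉p⇒x∈∁p; ∣∁p∣≡n∸∣p∣; ∣p∣≤n)
open import Data.List.Base
  using (List; []; _∷_; _++_; map; length; filter; filterᵇ; tabulate; allFin; cartesianProduct; cartesianProductWith)
open import Data.List.Properties using (filter-++; length-++; map-tabulate; map-∘; map-++)
import Data.List.Relation.Unary.All as All
open import Data.List.Relation.Unary.AllPairs using (allPairs?)
open import Data.Product.Base using (_×_; _,_; proj₁; proj₂; ∃)
open import Data.Sum.Base as Sum using (_⊎_; inj₁; inj₂)
open import Data.Vec.Base using (Vec; []; _∷_; lookup; there)
open import Function.Base using (_∘_; id)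
open import Function.Bundles using (_⇔_; mk⇔)
open import Level using (0ℓ)
open import Relation.Binary.Core using (Rel)
open import Relation.Binary.Definitions using (Decidable)
open import Relation.Binary.PropositionalEquality
  using (_≡_; _≢_; refl; sym; trans; cong; cong₂; subst; ≢-sym; module ≡-Reasoning)
open import Relation.Nullary.Decidable
  using (Dec; yes; no; does; ¬?; _→-dec_; _×-dec_; does-⇔; dec-true; dec-false)
open import Relation.Nullary.Negation using (¬_; contradiction)
open import Relation.Unary as U using (Pred)
open import Algebra.Properties.CommutativeSemigroup +-commutativeSemigroup
  using () renaming (x∙yz≈y∙xz to x+yz≡y+xz)
open import Algebra.Properties.CommutativeSemigroup *-commutativeSemigroup
  using () renaming (x∙yz≈y∙xz to x*yz≡y*xz)
open import Algebra.Properties.Group (AbelianGroup.group +-0-abelianGroup) using (∙-cancelˡ)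
open import Algebra.Properties.Semiring.Sum +-*-semiring
  using (sum-cong-≗; sum-replicate-zero; ∑-distrib-+; ∑-comm; ∑-permute; *-distribˡ-sum; *-distribʳ-sum)

open ≡-Reasoning

-- No bijection between colourings and matchings is built. Sums over colourings, weighted by a
-- function of the number of colours, and sums over matchings, weighted by a function of the number
-- of edges, obey the same recurrence on the first vertex. The weight has to be arbitrary: how many
-- fresh colours the first vertex can take depends on how many colours the other vertices use, and
-- the induction closes only if this factor goes into the weight. If the first vertex is matched to
-- v, then v stays as an isolated vertex and stands for the class of both, so no vertex has to be
-- renumbered and the count of classes needs no correction. The j-clique is a vertex cover of the
-- complement, so a matching has at most j edges; this makes `j ∸ i` an honest subtraction.
-- Polynomial identities are checked at large natural numbers only, where (x)_k is nonzero and can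
-- be cancelled.

private variable
  A B : Set
  n q : ℕ

-- Indicators and filtered lists

⟦_⟧ : Bool → ℤ
⟦ true ⟧  = 1ℤ
⟦ false ⟧ = 0ℤ

filter-map : {P : Pred A 0ℓ} {Q : Pred B 0ℓ} (P? : U.Decidable P) (Q? : U.Decidable Q) (f : A → B) →
             (∀ x → does (Q? (f x)) ≡ does (P? x)) →
             ∀ xs → filter Q? (map f xs) ≡ map f (filter P? xs)
filter-map P? Q? f eq [] = refl
filter-map P? Q? f eq (x ∷ xs) rewrite eq x with does (P? x)
... | true  = cong (f x ∷_) (filter-map P? Q? f eq xs)
... | false = filter-map P? Q? f eq xs

filter-none-map : {Q : Pred B 0ℓ} (Q? : U.Decidable Q) (f : A → B) →
             (∀ x → does (Q? (f x)) ≡ false) → ∀ xs → filter Q? (map f xs) ≡ []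
filter-none-map Q? f eq []       = refl
filter-none-map Q? f eq (x ∷ xs) rewrite eq x = filter-none-map Q? f eq xs

filter-filter : {P Q R : Pred A 0ℓ} (P? : U.Decidable P) (Q? : U.Decidable Q) (R? : U.Decidable R) →
             (∀ x → does (R? x) ≡ does (Q? x) ∧ does (P? x)) →
             ∀ xs → filter P? (filter Q? xs) ≡ filter R? xs
filter-filter P? Q? R? eq [] = refl
filter-filter P? Q? R? eq (x ∷ xs) rewrite eq x with does (Q? x)
... | false = filter-filter P? Q? R? eq xs
... | true with does (P? x)
... | true  = cong (x ∷_) (filter-filter P? Q? R? eq xs)
... | false = filter-filter P? Q? R? eq xs

filter-does : {P Q : Pred A 0ℓ} (P? : U.Decidable P) (Q? : U.Decidable Q) →
             (∀ x → does (P? x) ≡ does (Q? x)) → ∀ xs → filter P? xs ≡ filter Q? xs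
filter-does P? Q? eq [] = refl
filter-does P? Q? eq (x ∷ xs) rewrite eq x with does (Q? x)
... | true  = cong (x ∷_) (filter-does P? Q? eq xs)
... | false = filter-does P? Q? eq xs

-- Matchings

module _ {R : Rel A 0ℓ} (R? : Decidable R) where

  -- Counts without listing sublists: once e is chosen, the later candidates are cut down to those
  -- related to e. This is the shape of the recurrence of `matchingSum`.
  #pairwise : ℕ → List A → ℤ
  #pairwise zero    es       = 1ℤ
  #pairwise (suc i) []       = 0ℤ
  #pairwise (suc i) (e ∷ es) = #pairwise i (filter (R? e) es) + #pairwise (suc i) es

  private
    filter-all-∷ : {P : Pred A 0ℓ} (P? : U.Decidable P) (x : A) (xss : List (List A)) →
      filter (All.all? P?) (map (x ∷_) xss) ≡
      (if does (P? x) then map (x ∷_) (filter (All.all? P?) xss) else [])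
    filter-all-∷ P? x xss with does (P? x) in eq
    ... | true  = filter-map (All.all? P?) (All.all? P?) (x ∷_) (λ xs → cong (_∧ does (All.all? P? xs)) eq) xss
    ... | false = filter-none-map (All.all? P?) (x ∷_) (λ xs → cong (_∧ does (All.all? P? xs)) eq) xss

  -- For `#pairwise-correct`: the requirement that a whole tail be related to its head moves from
  -- the list of sublists to the list of candidates.
  filter-choose : {P : Pred A 0ℓ} (P? : U.Decidable P) (i : ℕ) (xs : List A) →
    filter (All.all? P?) (choose i xs) ≡ choose i (filter P? xs)
  filter-choose P? zero    xs = refl
  filter-choose P? (suc i) [] = refl
  filter-choose P? (suc i) (x ∷ xs)
    rewrite filter-++ (All.all? P?) (map (x ∷_) (choose i xs)) (choose (suc i) xs)
          | filter-all-∷ P? x (choose i xs)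
    with does (P? x)
  ... | true  = cong₂ _++_ (cong (map (x ∷_)) (filter-choose P? i xs)) (filter-choose P? (suc i) xs)
  ... | false = filter-choose P? (suc i) xs

  length-filter-∷ : ∀ x (xss : List (List A)) →
    length (filter (allPairs? R?) (map (x ∷_) xss)) ≡
    length (filter (allPairs? R?) (filter (All.all? (R? x)) xss))
  length-filter-∷ x [] = refl
  length-filter-∷ x (xs ∷ xss) with does (All.all? (R? x) xs)
  ... | false = length-filter-∷ x xss
  ... | true with does (allPairs? R? xs)
  ... | true  = cong suc (length-filter-∷ x xss)
  ... | false = length-filter-∷ x xss

  #pairwise-correct : ∀ i es → + length (filter (allPairs? R?) (choose i es)) ≡ #pairwise i es
  #pairwise-correct zero    es = refl
  #pairwise-correct (suc i) [] = refl
  #pairwise-correct (suc i) (e ∷ es) = begin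
    + length (filter AP? (map (e ∷_) (choose i es) ++ choose (suc i) es))
      ≡⟨ cong (+_ ∘ length) (filter-++ AP? (map (e ∷_) (choose i es)) _) ⟩
    + length (filter AP? (map (e ∷_) (choose i es)) ++ filter AP? (choose (suc i) es))
      ≡⟨ cong +_ (length-++ (filter AP? (map (e ∷_) (choose i es)))) ⟩
    + length (filter AP? (map (e ∷_) (choose i es))) + + length (filter AP? (choose (suc i) es))
      ≡⟨ cong₂ _+_ (cong +_ (trans (length-filter-∷ e (choose i es))
                                   (cong (length ∘ filter AP?) (filter-choose (R? e) i es))))
                   (#pairwise-correct (suc i) es) ⟩
    + length (filter AP? (choose i (filter (R? e) es))) + #pairwise (suc i) es
      ≡⟨ cong (_+ #pairwise (suc i) es) (#pairwise-correct i (filter (R? e) es)) ⟩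
    #pairwise i (filter (R? e) es) + #pairwise (suc i) es ∎
    where
    AP? = allPairs? R?

#pairwise-map : {R : Rel A 0ℓ} {S : Rel B 0ℓ} (R? : Decidable R) (S? : Decidable S) (f : A → B) →
  (∀ x y → does (S? (f x) (f y)) ≡ does (R? x y)) →
  ∀ i xs → #pairwise S? i (map f xs) ≡ #pairwise R? i xs
#pairwise-map R? S? f eq zero    xs = refl
#pairwise-map R? S? f eq (suc i) [] = refl
#pairwise-map R? S? f eq (suc i) (x ∷ xs) = cong₂ _+_
  (trans (cong (#pairwise S? i) (filter-map (R? x) (S? (f x)) f (eq x) xs))
         (#pairwise-map R? S? f eq i (filter (R? x) xs)))
  (#pairwise-map R? S? f eq (suc i) xs)

-- Weighted sums over matchings

BoolRel : ℕ → Set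
BoolRel n = Fin n → Fin n → Bool

tailRel : ∀ {n} → BoolRel (suc n) → BoolRel n
tailRel F u v = F (suc u) (suc v)

infixl 6 _∖_
_∖_ : ∀ {n} → BoolRel n → Fin n → BoolRel n
(F ∖ w) u v = (not (does (w ≟ u)) ∧ not (does (w ≟ v))) ∧ F u v

-- Σ ω |M| over all matchings M of F, by the recurrence which removes vertex 0;
-- the neighbour v matched to 0 is isolated instead of removed.
matchingSum : ∀ n → BoolRel n → (ℕ → ℤ) → ℤ
matchingSum zero    F ω = ω 0
matchingSum (suc n) F ω =
  matchingSum n (tailRel F) ω +
  ∑[ v < n ] (⟦ F zero (suc v) ⟧ * matchingSum n (tailRel F ∖ v) (ω ∘ suc))

-- As a weight in `matchingSum`, `δ i` selects the matchings with exactly i edges. Its recursion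
-- makes `δ (suc i) ∘ suc` compute to `δ i`, which is the weight left after one edge is taken.
δ : ℕ → ℕ → ℤ
δ zero    zero    = 1ℤ
δ zero    (suc k) = 0ℤ
δ (suc i) zero    = 0ℤ
δ (suc i) (suc k) = δ i k

isEdge : ∀ {n} → BoolRel n → Fin n × Fin n → Bool
isEdge F (u , v) = does (u <? v) ∧ F u v

edgeList : ∀ {n} → BoolRel n → List (Fin n × Fin n)
edgeList {n} F = filterᵇ (isEdge F) (cartesianProduct (allFin n) (allFin n))

private
  shift : ∀ {n} → Fin n × Fin n → Fin (suc n) × Fin (suc n)
  shift (u , v) = suc u , suc v

  star : ∀ {n m} → BoolRel (suc n) → (Fin m → Fin n) → List (Fin (suc n) × Fin (suc n))
  star F f = filterᵇ (isEdge F) (map (λ v → zero , suc v) (tabulate f))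

-- The lexicographic order puts the edges at vertex zero first. Pairs whose second entry is zero
-- fail the test u < v by computation, so each row may start at `suc`.
edgeList-suc : ∀ {n} (F : BoolRel (suc n)) →
  edgeList F ≡ star F id ++ map shift (edgeList (tailRel F))
edgeList-suc {n} F = begin
  edgeList F
    ≡⟨ filter-++ (T? ∘ isEdge F) (map (zero ,_) (tabulate suc)) _ ⟩
  filterᵇ (isEdge F) (map (zero ,_) (tabulate suc)) ++
  filterᵇ (isEdge F) (cartesianProduct (tabulate suc) (allFin (suc n)))
    ≡⟨ cong₂ (λ xs ys → filterᵇ (isEdge F) xs ++ filterᵇ (isEdge F) (cartesianProduct ys (allFin (suc n))))
             (trans (cong (map (zero ,_)) (sym (map-tabulate id suc))) (sym (map-∘ (allFin n))))
             (sym (map-tabulate id suc)) ⟩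
  star F id ++ filterᵇ (isEdge F) (cartesianProduct (map suc (allFin n)) (allFin (suc n)))
    ≡⟨ cong (star F id ++_) (rows (allFin n)) ⟩
  star F id ++ map shift (edgeList (tailRel F)) ∎
  where
  row : ∀ u → filterᵇ (isEdge F) (map (suc u ,_) (tabulate suc)) ≡
              map shift (filterᵇ (isEdge (tailRel F)) (map (u ,_) (allFin n)))
  row u = begin
    filterᵇ (isEdge F) (map (suc u ,_) (tabulate suc))
      ≡⟨ cong (filterᵇ (isEdge F) ∘ map (suc u ,_)) (sym (map-tabulate id suc)) ⟩
    filterᵇ (isEdge F) (map (suc u ,_) (map suc (allFin n)))
      ≡⟨ cong (filterᵇ (isEdge F)) (trans (sym (map-∘ (allFin n))) (map-∘ (allFin n))) ⟩
    filterᵇ (isEdge F) (map shift (map (u ,_) (allFin n)))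
      ≡⟨ filter-map (T? ∘ isEdge (tailRel F)) (T? ∘ isEdge F) shift (λ _ → refl) (map (u ,_) (allFin n)) ⟩
    map shift (filterᵇ (isEdge (tailRel F)) (map (u ,_) (allFin n))) ∎
  rows : ∀ us → filterᵇ (isEdge F) (cartesianProduct (map suc us) (allFin (suc n))) ≡
                map shift (filterᵇ (isEdge (tailRel F)) (cartesianProduct us (allFin n)))
  rows []       = refl
  rows (u ∷ us) = begin
    filterᵇ (isEdge F) (map (suc u ,_) (tabulate suc) ++ cartesianProduct (map suc us) (allFin (suc n)))
      ≡⟨ filter-++ (T? ∘ isEdge F) (map (suc u ,_) (tabulate suc)) _ ⟩
    filterᵇ (isEdge F) (map (suc u ,_) (tabulate suc)) ++
    filterᵇ (isEdge F) (cartesianProduct (map suc us) (allFin (suc n)))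
      ≡⟨ cong₂ _++_ (row u) (rows us) ⟩
    map shift (filterᵇ F′ (map (u ,_) (allFin n))) ++ map shift (filterᵇ F′ (cartesianProduct us (allFin n)))
      ≡⟨ sym (map-++ shift (filterᵇ F′ (map (u ,_) (allFin n))) _) ⟩
    map shift (filterᵇ F′ (map (u ,_) (allFin n)) ++ filterᵇ F′ (cartesianProduct us (allFin n)))
      ≡⟨ cong (map shift) (sym (filter-++ (T? ∘ F′) (map (u ,_) (allFin n)) _)) ⟩
    map shift (filterᵇ F′ (cartesianProduct (u ∷ us) (allFin n))) ∎
    where F′ = isEdge (tailRel F)

-- Any two edges of the star meet in vertex zero, so at most one of them is chosen; the sum runs
-- over that one. The map f is arbitrary for the sake of the induction along `tabulate`.
#pairwise-star : ∀ {n m} (F : BoolRel (suc n)) (f : Fin m → Fin n) i es →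
  #pairwise disjointEdges? (suc i) (star F f ++ es) ≡
  #pairwise disjointEdges? (suc i) es +
  ∑[ v < m ] (⟦ F zero (suc (f v)) ⟧ * #pairwise disjointEdges? i (filter (disjointEdges? (zero , suc (f v))) es))
#pairwise-star {m = zero}  F f i es = sym (+-identityʳ _)
#pairwise-star {m = suc m} F f i es with F zero (suc (f zero))
... | false = trans (#pairwise-star F (f ∘ suc) i es)
                (cong (λ s → #pairwise disjointEdges? (suc i) es + s) (sym (+-identityˡ _)))
... | true = begin
  #pairwise D? i (filter (D? e) (star F (f ∘ suc) ++ es)) + #pairwise D? (suc i) (star F (f ∘ suc) ++ es)
    ≡⟨ cong₂ (λ xs y → #pairwise D? i xs + y) drop (#pairwise-star F (f ∘ suc) i es) ⟩
  X + (#pairwise D? (suc i) es + Y)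
    ≡⟨ cong₂ _+_ (sym (*-identityˡ X)) refl ⟩
  1ℤ * X + (#pairwise D? (suc i) es + Y)
    ≡⟨ x+yz≡y+xz (1ℤ * X) (#pairwise D? (suc i) es) Y ⟩
  #pairwise D? (suc i) es + (1ℤ * X + Y) ∎
  where
  D? = disjointEdges?
  e = (zero , suc (f zero))
  X = #pairwise D? i (filter (D? e) es)
  Y = ∑[ v < m ] (⟦ F zero (suc (f (suc v))) ⟧ * #pairwise D? i (filter (D? (zero , suc (f (suc v)))) es))
  none : ∀ {k} (g : Fin k → _) → filter (D? e) (star F g) ≡ []
  none {zero}  g = refl
  none {suc k} g with F zero (suc (g zero))
  ... | true  = none (g ∘ suc)
  ... | false = none (g ∘ suc)
  drop : filter (D? e) (star F (f ∘ suc) ++ es) ≡ filter (D? e) es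
  drop = trans (filter-++ (D? e) (star F (f ∘ suc)) es) (cong (_++ filter (D? e) es) (none (f ∘ suc)))

-- Shifted edges never contain zero, so only v remains to be avoided. Here discarding edges from a
-- list becomes isolating a vertex.
filter-disjoint : ∀ {n} (F : BoolRel n) v →
  filter (disjointEdges? (zero , suc v)) (map shift (edgeList F)) ≡ map shift (edgeList (F ∖ v))
filter-disjoint {n} F v = begin
  filter (disjointEdges? (zero , suc v)) (map shift (edgeList F))
    ≡⟨ filter-map (T? ∘ avoids) _ shift (λ _ → refl) (edgeList F) ⟩
  map shift (filterᵇ avoids (edgeList F))
    ≡⟨ cong (map shift) (filter-filter (T? ∘ avoids) (T? ∘ isEdge F) (T? ∘ isEdge (F ∖ v)) reorder
         (cartesianProduct (allFin n) (allFin n))) ⟩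
  map shift (edgeList (F ∖ v)) ∎
  where
  avoids : Fin n × Fin n → Bool
  avoids (u , w) = not (does (v ≟ u)) ∧ not (does (v ≟ w))
  reorder : ∀ e → isEdge (F ∖ v) e ≡ isEdge F e ∧ avoids e
  reorder e@(u , w) = trans (cong (does (u <? w) ∧_) (∧-comm (avoids e) (F u w)))
                            (sym (∧-assoc (does (u <? w)) (F u w) (avoids e)))

sum-zero : ∀ {n} {f : Fin n → ℤ} → (∀ i → f i ≡ 0ℤ) → sum f ≡ 0ℤ
sum-zero {n} eq = trans (sum-cong-≗ eq) (sum-replicate-zero n)

matchingSum-zero : ∀ n (F : BoolRel n) → matchingSum n F (λ _ → 0ℤ) ≡ 0ℤ
matchingSum-zero zero    F = refl
matchingSum-zero (suc n) F = cong₂ _+_ (matchingSum-zero n _)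
  (sum-zero λ v → trans (cong (⟦ F zero (suc v) ⟧ *_) (matchingSum-zero n _)) (*-zeroʳ ⟦ F zero (suc v) ⟧))

#pairwise-edgeList : ∀ n (F : BoolRel n) i →
  #pairwise disjointEdges? i (edgeList F) ≡ matchingSum n F (δ i)
#pairwise-edgeList zero    F zero    = refl
#pairwise-edgeList zero    F (suc i) = refl
#pairwise-edgeList (suc n) F zero    = cong₂ _+_ (#pairwise-edgeList n (tailRel F) zero)
  (sym (sum-zero λ v → trans (cong (⟦ F zero (suc v) ⟧ *_) (matchingSum-zero n _)) (*-zeroʳ ⟦ F zero (suc v) ⟧)))
#pairwise-edgeList (suc n) F (suc i) = begin
  #pairwise D? (suc i) (edgeList F)
    ≡⟨ cong (#pairwise D? (suc i)) (edgeList-suc F) ⟩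
  #pairwise D? (suc i) (star F id ++ map shift (edgeList (tailRel F)))
    ≡⟨ #pairwise-star F id i (map shift (edgeList (tailRel F))) ⟩
  _ ≡⟨ cong₂ _+_ (shifted (suc i) (tailRel F))
         (sum-cong-≗ λ v → cong (⟦ F zero (suc v) ⟧ *_)
           (trans (cong (#pairwise D? i) (filter-disjoint (tailRel F) v)) (shifted i (tailRel F ∖ v)))) ⟩
  matchingSum (suc n) F (δ (suc i)) ∎
  where
  D? : ∀ {n} → Decidable (DisjointEdges {n})
  D? = disjointEdges?
  shifted : ∀ i (F : BoolRel n) → #pairwise D? i (map shift (edgeList F)) ≡ matchingSum n F (δ i)
  shifted i F = trans (#pairwise-map D? D? shift (λ _ _ → refl) i (edgeList F)) (#pairwise-edgeList n F i)

adjᵇ : ∀ {n} → Graph n → BoolRel n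
adjᵇ F u v = does (adj? F u v)

#matchings-matchingSum : ∀ {n} (F : Graph n) i → + #matchings F i ≡ matchingSum n (adjᵇ F) (δ i)
#matchings-matchingSum {n} F i = trans (#pairwise-correct disjointEdges? i (edges F))
  (trans (cong (#pairwise disjointEdges? i)
           (filter-does _ (T? ∘ isEdge (adjᵇ F)) (λ _ → refl) (cartesianProduct (allFin n) (allFin n))))
         (#pairwise-edgeList n (adjᵇ F) i))

-- Sums of indicators

⟦∧⟧ : ∀ x y → ⟦ x ∧ y ⟧ ≡ ⟦ x ⟧ * ⟦ y ⟧
⟦∧⟧ true  y = sym (*-identityˡ ⟦ y ⟧)
⟦∧⟧ false y = refl

⟦⟧-guard : ∀ b {x y : ℤ} → (b ≡ true → x ≡ y) → ⟦ b ⟧ * x ≡ ⟦ b ⟧ * y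
⟦⟧-guard true  eq = cong (1ℤ *_) (eq refl)
⟦⟧-guard false eq = refl

does⇒ : {P : Set} (P? : Dec P) → does P? ≡ true → P
does⇒ (yes p) _ = p

∧-true : ∀ {x y} → x ∧ y ≡ true → x ≡ true × y ≡ true
∧-true {true} {true} _ = refl , refl

sum-Fin-unique : ∀ {n} {P : Pred (Fin n) 0ℓ} (P? : U.Decidable P) → (∀ {u v} → P u → P v → u ≡ v) →
  ∑[ v < n ] ⟦ does (P? v) ⟧ ≡ ⟦ does (any? P?) ⟧
sum-Fin-unique {zero}  P? unique = refl
sum-Fin-unique {suc n} P? unique with P? zero
... | yes p0 = cong (λ s → 1ℤ + s) (sum-zero λ v → cong ⟦_⟧ (dec-false (P? (suc v)) λ p → 0≢1+n (unique p0 p)))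
... | no _   = trans (+-identityˡ _) (sum-Fin-unique (P? ∘ suc) (λ p p′ → suc-injective (unique p p′)))

sum-≟ : ∀ {n} (u : Fin n) → ∑[ v < n ] ⟦ does (u ≟ v) ⟧ ≡ 1ℤ
sum-≟ u = trans (sum-Fin-unique (u ≟_) (λ p p′ → trans (sym p) p′))
                (cong ⟦_⟧ (dec-true (any? (u ≟_)) (u , refl)))

-- Sums over colourings

∑ᵥ : ∀ n → (Vec (Fin q) n → ℤ) → ℤ
∑ᵥ         zero    f = f []
∑ᵥ {q = q} (suc n) f = ∑[ a < q ] ∑ᵥ n (λ c → f (a ∷ c))

∑ᵥ-cong : ∀ n {f g : Vec (Fin q) n → ℤ} → (∀ c → f c ≡ g c) → ∑ᵥ n f ≡ ∑ᵥ n g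
∑ᵥ-cong zero    eq = eq []
∑ᵥ-cong (suc n) eq = sum-cong-≗ λ a → ∑ᵥ-cong n (λ c → eq (a ∷ c))

∑ᵥ-+ : ∀ n (f g : Vec (Fin q) n → ℤ) → ∑ᵥ n (λ c → f c + g c) ≡ ∑ᵥ n f + ∑ᵥ n g
∑ᵥ-+ zero    f g = refl
∑ᵥ-+ {q = q} (suc n) f g = trans
  (sum-cong-≗ λ a → ∑ᵥ-+ n (λ c → f (a ∷ c)) (λ c → g (a ∷ c)))
  (∑-distrib-+ {q} (λ a → ∑ᵥ n (λ c → f (a ∷ c))) (λ a → ∑ᵥ n (λ c → g (a ∷ c))))

∑ᵥ-*ˡ : ∀ n x (f : Vec (Fin q) n → ℤ) → ∑ᵥ n (λ c → x * f c) ≡ x * ∑ᵥ n f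
∑ᵥ-*ˡ zero    x f = refl
∑ᵥ-*ˡ (suc n) x f = trans (sum-cong-≗ λ a → ∑ᵥ-*ˡ n x (λ c → f (a ∷ c))) (sym (*-distribˡ-sum x (λ a → ∑ᵥ n (λ c → f (a ∷ c)))))

∑ᵥ-comm : ∀ n {m} (f : Fin m → Vec (Fin q) n → ℤ) →
  ∑[ i < m ] ∑ᵥ n (f i) ≡ ∑ᵥ n (λ c → ∑[ i < m ] f i c)
∑ᵥ-comm zero    f = refl
∑ᵥ-comm (suc n) f = trans (∑-comm (λ i a → ∑ᵥ n (λ c → f i (a ∷ c)))) (sum-cong-≗ λ a → ∑ᵥ-comm n (λ i c → f i (a ∷ c)))

length-filter-map : {P : Pred B 0ℓ} (P? : U.Decidable P) (f : A → B) (xs : List A) →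
  length (filter P? (map f xs)) ≡ length (filter (P? ∘ f) xs)
length-filter-map P? f [] = refl
length-filter-map P? f (x ∷ xs) with does (P? (f x))
... | true  = cong suc (length-filter-map P? f xs)
... | false = length-filter-map P? f xs

length-filter-colourings : ∀ n {P : Pred (Vec (Fin q) n) 0ℓ} (P? : U.Decidable P) →
  + length (filter P? (allColourings n q)) ≡ ∑ᵥ n (λ c → ⟦ does (P? c) ⟧)
length-filter-colourings zero P? with does (P? [])
... | true  = refl
... | false = refl
length-filter-colourings {q = q} (suc n) P? = rows id
  where
  rows : ∀ {m} (f : Fin m → Fin q) →
    + length (filter P? (cartesianProductWith _∷_ (tabulate f) (allColourings n q))) ≡
    ∑[ a < m ] ∑ᵥ n (λ c → ⟦ does (P? (f a ∷ c)) ⟧)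
  rows {zero}  f = refl
  rows {suc m} f = trans
    (cong +_ (trans (cong length (filter-++ P? (map (f zero ∷_) (allColourings n q)) _))
                    (length-++ (filter P? (map (f zero ∷_) (allColourings n q))))))
    (cong₂ _+_ (trans (cong +_ (length-filter-map P? (f zero ∷_) (allColourings n q)))
                      (length-filter-colourings n (λ c → P? (f zero ∷ c))))
               (rows (f ∘ suc)))

occurs? : (a : Fin q) (c : Vec (Fin q) n) → Dec (∃ λ v → lookup c v ≡ a)
occurs? a c = any? (λ v → lookup c v ≟ a)

#colours : Vec (Fin q) n → ℕ
#colours []      = 0
#colours (a ∷ c) = if does (occurs? a c) then #colours c else suc (#colours c)

sum-occurs : (c : Vec (Fin q) n) → ∑[ a < q ] ⟦ does (occurs? a c) ⟧ ≡ + #colours c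
sum-occurs {q = q} [] = sum-zero {q} λ _ → refl
sum-occurs {q = q} (b ∷ c) with occurs? b c
... | yes (v , cv≡b) = trans (sum-cong-≗ λ a → cong ⟦_⟧ (does-⇔ (mk⇔ (drop a) (λ (v , p) → suc v , p)) (occurs? a (b ∷ c)) (occurs? a c))) (sum-occurs c)
  where
  drop : ∀ a → ∃ (λ v → lookup (b ∷ c) v ≡ a) → ∃ (λ v → lookup c v ≡ a)
  drop a (zero  , b≡a) = v , trans cv≡b b≡a
  drop a (suc w , p)   = w , p
... | no ∄b = begin
  ∑[ a < q ] ⟦ does (occurs? a (b ∷ c)) ⟧
    ≡⟨ sum-cong-≗ split ⟩
  ∑[ a < q ] (⟦ does (b ≟ a) ⟧ + ⟦ does (occurs? a c) ⟧)
    ≡⟨ ∑-distrib-+ {q} _ _ ⟩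
  ∑[ a < q ] ⟦ does (b ≟ a) ⟧ + ∑[ a < q ] ⟦ does (occurs? a c) ⟧
    ≡⟨ cong₂ _+_ (sum-≟ b) (sum-occurs c) ⟩
  + suc (#colours c) ∎
  where
  split : ∀ a → ⟦ does (occurs? a (b ∷ c)) ⟧ ≡ ⟦ does (b ≟ a) ⟧ + ⟦ does (occurs? a c) ⟧
  split a with b ≟ a
  ... | yes refl = sym (cong (λ x → 1ℤ + ⟦ x ⟧) (dec-false (occurs? b c) ∄b))
  ... | no  _    = sym (+-identityˡ _)

-- Properness seen from the complement: every colour class is a clique of F. For a bare Boolean
-- relation the condition can also be stated after vertex zero is dropped or a vertex is isolated.
Compatible : BoolRel n → Vec (Fin q) n → Set
Compatible F c = ∀ u v → u ≢ v → lookup c u ≡ lookup c v → F u v ≡ true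

compatible? : (F : BoolRel n) (c : Vec (Fin q) n) → Dec (Compatible F c)
compatible? F c = all? λ u → all? λ v → ¬? (u ≟ v) →-dec (lookup c u ≟ lookup c v) →-dec (F u v Bool.≟ true)

Symmetricᵇ : BoolRel n → Set
Symmetricᵇ F = ∀ u v → F u v ≡ F v u

-- All that the count of colourings keeps of the bipartition: a colour class, being a clique of F,
-- has at most two vertices.
TriangleFree : BoolRel n → Set
TriangleFree F = ∀ u v w → F u v ≡ true → F u w ≡ true → F v w ≡ true → ⊥

∖-⊆ : (F : BoolRel n) (w u v : Fin n) → (F ∖ w) u v ≡ true → F u v ≡ true
∖-⊆ F w u v = proj₂ ∘ ∧-true

∖-avoidsˡ : (F : BoolRel n) (w u v : Fin n) → (F ∖ w) u v ≡ true → w ≢ u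
∖-avoidsˡ F w u v uv w≡u with () ← trans (sym (proj₁ (∧-true (proj₁ (∧-true uv))))) (cong not (dec-true (w ≟ u) w≡u))

∖-avoidsʳ : (F : BoolRel n) (w u v : Fin n) → (F ∖ w) u v ≡ true → w ≢ v
∖-avoidsʳ F w u v uv w≡v with () ← trans (sym (proj₂ (∧-true {not (does (w ≟ u))} (proj₁ (∧-true uv))))) (cong not (dec-true (w ≟ v) w≡v))

∖-intro : (F : BoolRel n) (w u v : Fin n) → w ≢ u → w ≢ v → F u v ≡ true → (F ∖ w) u v ≡ true
∖-intro F w u v w≢u w≢v uv = cong₂ _∧_ (cong₂ (λ x y → not x ∧ not y) (dec-false (w ≟ u) w≢u) (dec-false (w ≟ v) w≢v)) uv

module _ {F : BoolRel (suc n)} (F-sym : Symmetricᵇ F) (Δ-free : TriangleFree F) where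

  private
    F′ = tailRel F

    -- The vertex v that shares the colour a with the first vertex. Compatibility with v isolated
    -- forces v to be alone in its class within c, so that summing over v counts no colouring twice.
    Partner : Fin q → Vec (Fin q) n → Pred (Fin n) 0ℓ
    Partner a c v = F zero (suc v) ≡ true × lookup c v ≡ a × Compatible (F′ ∖ v) c

    partner? : (a : Fin q) (c : Vec (Fin q) n) → U.Decidable (Partner a c)
    partner? a c v = (F zero (suc v) Bool.≟ true) ×-dec (lookup c v ≟ a) ×-dec compatible? (F′ ∖ v) c

    -- A second vertex of the same colour would have to be adjacent to v, which has lost all its
    -- edges.
    isolated-unique : (c : Vec (Fin q) n) {v w : Fin n} → Compatible (F′ ∖ v) c → lookup c v ≡ lookup c w → v ≡ w
    isolated-unique c {v} {w} comp same with v ≟ w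
    ... | yes v≡w = v≡w
    ... | no  v≢w = contradiction refl (∖-avoidsˡ F′ v v w (comp v w v≢w same))

    partner-unique : ∀ (a : Fin q) c {v w} → Partner a c v → Partner a c w → v ≡ w
    partner-unique a c (_ , cv , comp) (_ , cw , _) = isolated-unique c comp (trans cv (sym cw))

    partner-⇔ : ∀ (a : Fin q) c → ∃ (Partner a c) ⇔ ((∃ λ v → lookup c v ≡ a) × Compatible F (a ∷ c))
    partner-⇔ {q = q} a c = mk⇔ to from
      where
      to : ∃ (Partner a c) → (∃ λ v → lookup c v ≡ a) × Compatible F (a ∷ c)
      to (v , 0v , cv , comp) = (v , cv) , compat
        where
        zero-suc : ∀ w → a ≡ lookup c w → F zero (suc w) ≡ true
        zero-suc w a≡cw = subst (λ w → F zero (suc w) ≡ true) (isolated-unique c comp (trans cv a≡cw)) 0v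
        compat : Compatible F (a ∷ c)
        compat zero    zero    0≢0 _    = contradiction refl 0≢0
        compat zero    (suc w) _   a≡cw = zero-suc w a≡cw
        compat (suc u) zero    _   cu≡a = trans (F-sym (suc u) zero) (zero-suc u (sym cu≡a))
        compat (suc u) (suc w) u≢w same = ∖-⊆ F′ v u w (comp u w (u≢w ∘ cong suc) same)
      from : (∃ λ v → lookup c v ≡ a) × Compatible F (a ∷ c) → ∃ (Partner a c)
      from ((v , cv) , comp) = v , at v cv , cv , compat
        where
        at : ∀ w → lookup c w ≡ a → F zero (suc w) ≡ true
        at w cw = comp zero (suc w) (λ ()) (sym cw)
        compat : Compatible (F′ ∖ v) c
        compat u w u≢w same = ∖-intro F′ v u w
          -- If u were v, then the first vertex, v and w would share the colour a and form a
          -- triangle of F; likewise if w were v.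
          (λ { refl → Δ-free zero (suc v) (suc w) (at v cv) (at w (trans (sym same) cv)) uw })
          (λ { refl → Δ-free zero (suc u) (suc v) (at u (trans same cv)) (at v cv) uw })
          uw
          where uw = comp (suc u) (suc w) (u≢w ∘ suc-injective) same

    fresh-⇔ : ∀ (a : Fin q) c → ¬ (∃ λ v → lookup c v ≡ a) → Compatible F (a ∷ c) ⇔ Compatible F′ c
    fresh-⇔ a c ∄a = mk⇔ (λ comp u v u≢v → comp (suc u) (suc v) (u≢v ∘ suc-injective)) from
      where
      from : Compatible F′ c → Compatible F (a ∷ c)
      from comp zero    zero    0≢0 _    = contradiction refl 0≢0
      from comp zero    (suc w) _   a≡cw = contradiction (w , sym a≡cw) ∄a
      from comp (suc u) zero    _   cu≡a = contradiction (u , cu≡a) ∄a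
      from comp (suc u) (suc w) u≢w same = comp u w (u≢w ∘ cong suc) same

    does-≟-true : ∀ b → does (b Bool.≟ true) ≡ b
    does-≟-true true  = refl
    does-≟-true false = refl

    ∑-partners : ∀ (a : Fin q) c (x : ℤ) →
      ∑[ v < n ] (⟦ F zero (suc v) ⟧ * (⟦ does (lookup c v ≟ a) ⟧ * (⟦ does (compatible? (F′ ∖ v) c) ⟧ * x))) ≡
      ⟦ does (occurs? a c) ∧ does (compatible? F (a ∷ c)) ⟧ * x
    ∑-partners a c x = begin
      ∑[ v < n ] (⟦ F zero (suc v) ⟧ * (⟦ does (lookup c v ≟ a) ⟧ * (⟦ does (compatible? (F′ ∖ v) c) ⟧ * x)))
        ≡⟨ sum-cong-≗ collect ⟩
      ∑[ v < n ] (⟦ does (partner? a c v) ⟧ * x)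
        ≡⟨ *-distribʳ-sum {n} x _ ⟨
      (∑[ v < n ] ⟦ does (partner? a c v) ⟧) * x
        ≡⟨ cong (_* x) (sum-Fin-unique (partner? a c) (partner-unique a c)) ⟩
      ⟦ does (any? (partner? a c)) ⟧ * x
        ≡⟨ cong (λ b → ⟦ b ⟧ * x) (does-⇔ (partner-⇔ a c) (any? (partner? a c)) (occurs? a c ×-dec compatible? F (a ∷ c))) ⟩
      ⟦ does (occurs? a c) ∧ does (compatible? F (a ∷ c)) ⟧ * x ∎
      where
      collect : ∀ v → ⟦ F zero (suc v) ⟧ * (⟦ does (lookup c v ≟ a) ⟧ * (⟦ does (compatible? (F′ ∖ v) c) ⟧ * x)) ≡
                      ⟦ does (partner? a c v) ⟧ * x
      collect v = begin
        ⟦ b₁ ⟧ * (⟦ b₂ ⟧ * (⟦ b₃ ⟧ * x))   ≡⟨ assoc ⟦ b₁ ⟧ ⟦ b₂ ⟧ ⟦ b₃ ⟧ x ⟩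
        ⟦ b₁ ⟧ * (⟦ b₂ ⟧ * ⟦ b₃ ⟧) * x     ≡⟨ cong (λ y → ⟦ b₁ ⟧ * y * x) (⟦∧⟧ b₂ b₃) ⟨
        ⟦ b₁ ⟧ * ⟦ b₂ ∧ b₃ ⟧ * x           ≡⟨ cong (_* x) (⟦∧⟧ b₁ (b₂ ∧ b₃)) ⟨
        ⟦ b₁ ∧ b₂ ∧ b₃ ⟧ * x               ≡⟨ cong (λ b → ⟦ b ∧ b₂ ∧ b₃ ⟧ * x) (does-≟-true b₁) ⟨
        ⟦ does (partner? a c v) ⟧ * x      ∎
        where
        b₁ = F zero (suc v)
        b₂ = does (lookup c v ≟ a)
        b₃ = does (compatible? (F′ ∖ v) c)
        assoc : ∀ i j k l → i * (j * (k * l)) ≡ i * (j * k) * l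
        assoc = solve-∀

    -- The first vertex gets either a fresh colour or the colour of a vertex v
    -- adjacent to it in F; as F is triangle-free, v is then the only vertex of
    -- its colour, that is, c is compatible even with F′ ∖ v.
    ∑-first-colour : (c : Vec (Fin q) n) (φ : ℕ → ℤ) →
      ∑[ a < q ] (⟦ does (compatible? F (a ∷ c)) ⟧ * φ (#colours (a ∷ c))) ≡
      ⟦ does (compatible? F′ c) ⟧ * ((+ q - + #colours c) * φ (suc (#colours c))) +
      ∑[ v < n ] (⟦ F zero (suc v) ⟧ * (⟦ does (compatible? (F′ ∖ v) c) ⟧ * φ (#colours c)))
    ∑-first-colour {q = q} c φ = begin
      ∑[ a < q ] (⟦ does (compatible? F (a ∷ c)) ⟧ * φ (#colours (a ∷ c)))
        ≡⟨ sum-cong-≗ split ⟩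
      ∑[ a < q ] ((1ℤ - ⟦ does (occurs? a c) ⟧) * K + ∑[ v < n ] (⟦ does (lookup c v ≟ a) ⟧ * M v))
        ≡⟨ ∑-distrib-+ {q} _ _ ⟩
      ∑[ a < q ] ((1ℤ - ⟦ does (occurs? a c) ⟧) * K) + ∑[ a < q ] ∑[ v < n ] (⟦ does (lookup c v ≟ a) ⟧ * M v)
        ≡⟨ cong₂ _+_ fresh (trans (∑-comm {q} {n} _) (sum-cong-≗ λ v → trans (sym (*-distribʳ-sum {q} (M v) _))
             (trans (cong (_* M v) (sum-≟ (lookup c v))) (*-identityˡ (M v))))) ⟩
      (+ q - + #colours c) * K + ∑[ v < n ] M v
        ≡⟨ cong (_+ ∑[ v < n ] M v) (x*yz≡y*xz (+ q - + #colours c) ⟦ does (compatible? F′ c) ⟧ (φ (suc (#colours c)))) ⟩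
      ⟦ does (compatible? F′ c) ⟧ * ((+ q - + #colours c) * φ (suc (#colours c))) + ∑[ v < n ] M v ∎
      where
      K = ⟦ does (compatible? F′ c) ⟧ * φ (suc (#colours c))
      M : Fin n → ℤ
      M v = ⟦ F zero (suc v) ⟧ * (⟦ does (compatible? (F′ ∖ v) c) ⟧ * φ (#colours c))
      split : ∀ a → ⟦ does (compatible? F (a ∷ c)) ⟧ * φ (#colours (a ∷ c)) ≡
                    (1ℤ - ⟦ does (occurs? a c) ⟧) * K + ∑[ v < n ] (⟦ does (lookup c v ≟ a) ⟧ * M v)
      -- The equation is introduced before the split on `occurs? a c`, so that the split also
      -- evaluates its indicator: the sum over partners becomes the whole term if a occurs in c, and
      -- 0 if a is fresh.
      split a with partners ← trans (sum-cong-≗ {n} λ v → x*yz≡y*xz ⟦ does (lookup c v ≟ a) ⟧ ⟦ F zero (suc v) ⟧ _) (∑-partners a c (φ (#colours c)))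
              with occurs? a c
      ... | yes _  = trans (sym partners) (sym (+-identityˡ _))
      ... | no  ∄a = trans (cong (λ b → ⟦ b ⟧ * φ (suc (#colours c))) (does-⇔ (fresh-⇔ a c ∄a) (compatible? F (a ∷ c)) (compatible? F′ c)))
                           (trans (unit K) (cong (λ s → (1ℤ - 0ℤ) * K + s) (sym partners)))
        where
        unit : ∀ K → K ≡ (1ℤ - 0ℤ) * K + 0ℤ
        unit = solve-∀
      fresh : ∑[ a < q ] ((1ℤ - ⟦ does (occurs? a c) ⟧) * K) ≡ (+ q - + #colours c) * K
      fresh = trans (sym (*-distribʳ-sum {q} K _)) (cong (_* K) (complement-count (λ a → ⟦ does (occurs? a c) ⟧) (sum-occurs c)))
        where
        complement-count : ∀ {m s} (f : Fin m → ℤ) → sum f ≡ s → ∑[ a < m ] (1ℤ - f a) ≡ + m - s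
        complement-count {m} f refl = go m f
          where
          step : ∀ x m s → 1ℤ - x + (m - s) ≡ 1ℤ + m - (x + s)
          step = solve-∀
          go : ∀ m (f : Fin m → ℤ) → ∑[ a < m ] (1ℤ - f a) ≡ + m - sum f
          go zero    f = refl
          go (suc m) f = trans (cong (λ s → 1ℤ - f zero + s) (go m (f ∘ suc))) (step (f zero) (+ m) (sum (f ∘ suc)))

  -- The colour of the first vertex is summed innermost, with the rest of the colouring fixed. The
  -- factor `+ q - + #colours c` depends on c only through its number of colours, so both parts are
  -- again sums of the original shape.
  ∑ᵥ-compatible-suc : ∀ q (φ : ℕ → ℤ) →
    ∑ᵥ {q} (suc n) (λ c → ⟦ does (compatible? F c) ⟧ * φ (#colours c)) ≡
    ∑ᵥ {q} n (λ c → ⟦ does (compatible? F′ c) ⟧ * ((+ q - + #colours c) * φ (suc (#colours c)))) +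
    ∑[ v < n ] (⟦ F zero (suc v) ⟧ * ∑ᵥ {q} n (λ c → ⟦ does (compatible? (F′ ∖ v) c) ⟧ * φ (#colours c)))
  ∑ᵥ-compatible-suc q φ = begin
    ∑ᵥ {q} (suc n) (λ c → ⟦ does (compatible? F c) ⟧ * φ (#colours c))
      ≡⟨ ∑ᵥ-comm n {q} (λ a c → ⟦ does (compatible? F (a ∷ c)) ⟧ * φ (#colours (a ∷ c))) ⟩
    ∑ᵥ {q} n (λ c → ∑[ a < q ] (⟦ does (compatible? F (a ∷ c)) ⟧ * φ (#colours (a ∷ c))))
      ≡⟨ ∑ᵥ-cong n (λ c → ∑-first-colour c φ) ⟩
    ∑ᵥ {q} n (λ c → fresh c + ∑[ v < n ] (⟦ F zero (suc v) ⟧ * repeated v c))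
      ≡⟨ ∑ᵥ-+ n fresh _ ⟩
    ∑ᵥ {q} n fresh + ∑ᵥ {q} n (λ c → ∑[ v < n ] (⟦ F zero (suc v) ⟧ * repeated v c))
      ≡⟨ cong (λ s → ∑ᵥ {q} n fresh + s) (trans (sym (∑ᵥ-comm n (λ v c → ⟦ F zero (suc v) ⟧ * repeated v c)))
                                                (sum-cong-≗ λ v → ∑ᵥ-*ˡ n ⟦ F zero (suc v) ⟧ (repeated v))) ⟩
    ∑ᵥ {q} n fresh + ∑[ v < n ] (⟦ F zero (suc v) ⟧ * ∑ᵥ {q} n (repeated v)) ∎
    where
    fresh : Vec (Fin q) n → ℤ
    fresh c = ⟦ does (compatible? F′ c) ⟧ * ((+ q - + #colours c) * φ (suc (#colours c)))
    repeated : Fin n → Vec (Fin q) n → ℤ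
    repeated v c = ⟦ does (compatible? (F′ ∖ v) c) ⟧ * φ (#colours c)

-- Vertex covers and the size of matchings

Cover : BoolRel n → Subset n → Set
Cover F K = ∀ u v → F u v ≡ true → u ∈ K ⊎ v ∈ K

-- Each edge of a matching uses up a vertex of the cover, so the weight matters only up to the size
-- of K. If zero lies in K, its edge is charged to zero; otherwise the mate v lies in K and is
-- removed from it as it is isolated.
matchingSum-cong-cover : ∀ n (F : BoolRel n) (K : Subset n) → Cover F K → {ω ω′ : ℕ → ℤ} →
  (∀ {i} → i ≤ ∣ K ∣ → ω i ≡ ω′ i) → matchingSum n F ω ≡ matchingSum n F ω′
matchingSum-cong-cover zero    F []            cover eq = eq z≤n
matchingSum-cong-cover (suc n) F (inside ∷ K)  cover eq = cong₂ _+_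
  (matchingSum-cong-cover n F′ K cover′ (eq ∘ ℕ.m≤n⇒m≤1+n))
  (sum-cong-≗ λ v → cong (⟦ F zero (suc v) ⟧ *_)
    (matchingSum-cong-cover n (F′ ∖ v) K (λ u w → cover′ u w ∘ ∖-⊆ F′ v u w) (eq ∘ s≤s)))
  where
  F′ = tailRel F
  cover′ : Cover F′ K
  cover′ u v = Sum.map drop-there drop-there ∘ cover (suc u) (suc v)
matchingSum-cong-cover (suc n) F (outside ∷ K) cover eq = cong₂ _+_
  (matchingSum-cong-cover n F′ K cover′ eq)
  (sum-cong-≗ λ v → ⟦⟧-guard (F zero (suc v)) λ 0v →
    matchingSum-cong-cover n (F′ ∖ v) (K ─ v) (cover-∖ v)
      (λ i≤ → eq (ℕ.≤-<-trans i≤ (x∈p⇒∣p-x∣<∣p∣ (endpoint v 0v)))))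
  where
  F′ = tailRel F
  cover′ : Cover F′ K
  cover′ u v = Sum.map drop-there drop-there ∘ cover (suc u) (suc v)
  endpoint : ∀ v → F zero (suc v) ≡ true → v ∈ K
  endpoint v 0v with inj₂ (there v∈K) ← cover zero (suc v) 0v = v∈K
  cover-∖ : ∀ v → Cover (F′ ∖ v) (K ─ v)
  cover-∖ v u w uw = Sum.map
    (λ u∈K → x∈p∧x≢y⇒x∈p-y u∈K (≢-sym (∖-avoidsˡ F′ v u w uw)))
    (λ w∈K → x∈p∧x≢y⇒x∈p-y w∈K (≢-sym (∖-avoidsʳ F′ v u w uw)))
    (cover′ u w (∖-⊆ F′ v u w uw))

matchingSum-cong-≤ : ∀ n (F : BoolRel n) {ω ω′ : ℕ → ℤ} →
  (∀ {i} → i ≤ n → ω i ≡ ω′ i) → matchingSum n F ω ≡ matchingSum n F ω′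
matchingSum-cong-≤ n F eq = matchingSum-cong-cover n F ⊤ (λ _ _ _ → inj₁ ∈⊤)
  (λ {i} i≤ → eq (subst (i ≤_) (∣⊤∣≡n n) i≤))

matchingSum-linear : ∀ n (F : BoolRel n) {m} (ω : Fin m → ℕ → ℤ) (x : Fin m → ℤ) →
  matchingSum n F (λ i → ∑[ k < m ] (ω k i * x k)) ≡ ∑[ k < m ] (matchingSum n F (ω k) * x k)
matchingSum-linear zero    F ω x = refl
matchingSum-linear (suc n) F {m} ω x = begin
  matchingSum n F′ (λ i → ∑[ k < m ] (ω k i * x k)) +
  ∑[ v < n ] (⟦ F zero (suc v) ⟧ * matchingSum n (F′ ∖ v) (λ i → ∑[ k < m ] (ω k (suc i) * x k)))
    ≡⟨ cong₂ _+_ (matchingSum-linear n F′ ω x) (sum-cong-≗ λ v → begin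
         ⟦ F zero (suc v) ⟧ * matchingSum n (F′ ∖ v) (λ i → ∑[ k < m ] (ω k (suc i) * x k))
           ≡⟨ cong (⟦ F zero (suc v) ⟧ *_) (matchingSum-linear n (F′ ∖ v) (λ k → ω k ∘ suc) x) ⟩
         ⟦ F zero (suc v) ⟧ * ∑[ k < m ] (S v k * x k)
           ≡⟨ *-distribˡ-sum ⟦ F zero (suc v) ⟧ (λ k → S v k * x k) ⟩
         ∑[ k < m ] (⟦ F zero (suc v) ⟧ * (S v k * x k))
           ≡⟨ (sum-cong-≗ λ k → sym (*-assoc ⟦ F zero (suc v) ⟧ (S v k) (x k))) ⟩
         ∑[ k < m ] (⟦ F zero (suc v) ⟧ * S v k * x k) ∎) ⟩
  ∑[ k < m ] (matchingSum n F′ (ω k) * x k) + ∑[ v < n ] ∑[ k < m ] (⟦ F zero (suc v) ⟧ * S v k * x k)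
    ≡⟨ cong (λ s → ∑[ k < m ] (matchingSum n F′ (ω k) * x k) + s) (∑-comm {n} {m} _) ⟩
  ∑[ k < m ] (matchingSum n F′ (ω k) * x k) + ∑[ k < m ] ∑[ v < n ] (⟦ F zero (suc v) ⟧ * S v k * x k)
    ≡⟨ ∑-distrib-+ {m} _ _ ⟨
  ∑[ k < m ] (matchingSum n F′ (ω k) * x k + ∑[ v < n ] (⟦ F zero (suc v) ⟧ * S v k * x k))
    ≡⟨ (sum-cong-≗ {m} λ k → begin
         matchingSum n F′ (ω k) * x k + ∑[ v < n ] (⟦ F zero (suc v) ⟧ * S v k * x k)
           ≡⟨ cong (λ s → matchingSum n F′ (ω k) * x k + s) (sym (*-distribʳ-sum {n} (x k) (λ v → ⟦ F zero (suc v) ⟧ * S v k))) ⟩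
         matchingSum n F′ (ω k) * x k + (∑[ v < n ] (⟦ F zero (suc v) ⟧ * S v k)) * x k
           ≡⟨ sym (*-distribʳ-+ (x k) (matchingSum n F′ (ω k)) _) ⟩
         matchingSum (suc n) F (ω k) * x k ∎) ⟩
  ∑[ k < m ] (matchingSum (suc n) F (ω k) * x k) ∎
  where
  F′ = tailRel F
  S : Fin n → Fin m → ℤ
  S v k = matchingSum n (F′ ∖ v) (ω k ∘ suc)

∑-δ : ∀ {i j} → i ≤ j → (ω : ℕ → ℤ) → ∑[ k ≤ j ] (δ (toℕ k) i * ω (toℕ k)) ≡ ω i
∑-δ {zero}  {j} _ ω = trans (cong₂ _+_ (*-identityˡ (ω 0)) (sum-zero {j} λ _ → refl)) (+-identityʳ (ω 0))
∑-δ {suc i} (s≤s i≤j) ω = trans (+-identityˡ _) (∑-δ i≤j (ω ∘ suc))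

-- Up to the size of K, which no matching exceeds, ω is the combination of the weights `δ k` with
-- coefficients `ω k`; linearity does the rest.
matchingSum-δ : ∀ n (F : BoolRel n) (K : Subset n) → Cover F K → (ω : ℕ → ℤ) →
  matchingSum n F ω ≡ ∑[ k ≤ ∣ K ∣ ] (matchingSum n F (δ (toℕ k)) * ω (toℕ k))
matchingSum-δ n F K cover ω = trans
  (matchingSum-cong-cover n F K cover (λ i≤ → sym (∑-δ i≤ ω)))
  (matchingSum-linear n F {suc ∣ K ∣} (δ ∘ toℕ) (ω ∘ toℕ))

-- Induction with φ varying. A fresh colour replaces φ(r) by (q - r) φ(r + 1), and q - r is the next
-- factor of the falling factorial. A repeated colour keeps φ, and one more vertex with one more
-- edge leaves the number of classes as it is: `suc n ∸ suc i` computes to `n ∸ i`.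
∑ᵥ-compatible : ∀ n q {F : BoolRel n} → Symmetricᵇ F → TriangleFree F → (φ : ℕ → ℤ) →
  ∑ᵥ {q} n (λ c → ⟦ does (compatible? F c) ⟧ * φ (#colours c)) ≡
  matchingSum n F (λ i → falling (+ q) (n ∸ i) * φ (n ∸ i))
∑ᵥ-compatible zero    q F-sym Δ-free φ = refl
∑ᵥ-compatible (suc n) q {F} F-sym Δ-free φ = begin
  ∑ᵥ {q} (suc n) (λ c → ⟦ does (compatible? F c) ⟧ * φ (#colours c))
    ≡⟨ ∑ᵥ-compatible-suc F-sym Δ-free q φ ⟩
  _ ≡⟨ cong₂ _+_
         (trans (∑ᵥ-compatible n q F′-sym F′-free (λ r → (+ q - + r) * φ (suc r)))
                (matchingSum-cong-≤ n F′ absorb))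
         (sum-cong-≗ λ v → cong (⟦ F zero (suc v) ⟧ *_)
           (∑ᵥ-compatible n q (∖-sym v) (∖-free v) φ)) ⟩
  matchingSum (suc n) F (λ i → falling (+ q) (suc n ∸ i) * φ (suc n ∸ i)) ∎
  where
  F′ = tailRel F
  F′-sym : Symmetricᵇ F′
  F′-sym u v = F-sym (suc u) (suc v)
  F′-free : TriangleFree F′
  F′-free u v w = Δ-free (suc u) (suc v) (suc w)
  ∖-sym : ∀ v → Symmetricᵇ (F′ ∖ v)
  ∖-sym v u w = cong₂ _∧_ (Bool.∧-comm (not (does (v ≟ u))) _) (F′-sym u w)
  ∖-free : ∀ v → TriangleFree (F′ ∖ v)
  ∖-free v x y z xy xz yz = F′-free x y z (∖-⊆ F′ v x y xy) (∖-⊆ F′ v x z xz) (∖-⊆ F′ v y z yz)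
  -- `suc n ∸ i` is `suc (n ∸ i)` only while i is at most n, hence the appeal to
  -- `matchingSum-cong-≤`.
  absorb : ∀ {i} → i ≤ n → falling (+ q) (n ∸ i) * ((+ q - + (n ∸ i)) * φ (suc (n ∸ i))) ≡
                           falling (+ q) (suc n ∸ i) * φ (suc n ∸ i)
  absorb {i} i≤n rewrite ℕ.+-∸-assoc 1 i≤n = sym (*-assoc (falling (+ q) (n ∸ i)) _ _)

-- Colourings of bicliques

isProper⇔compatible : (G : Graph n) (c : Vec (Fin q) n) → IsProper G c ⇔ Compatible (adjᵇ (complement G)) c
isProper⇔compatible G c = mk⇔
  (λ proper u v u≢v same → dec-true (adj? (complement G) u v) (u≢v , λ uv → proper u v uv same))
  (λ comp u v uv same → proj₂ (does⇒ (adj? (complement G) u v) (comp u v (λ u≡v → irrefl G u≡v uv) same)) uv)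

#properColourings-matchingSum : (G : Graph n) → TriangleFree (adjᵇ (complement G)) → ∀ q →
  + #properColourings G q ≡ matchingSum n (adjᵇ (complement G)) (λ i → falling (+ q) (n ∸ i))
#properColourings-matchingSum {n} G Δ-free q = begin
  + #properColourings G q
    ≡⟨ length-filter-colourings n (isProper? G) ⟩
  ∑ᵥ {q} n (λ c → ⟦ does (isProper? G c) ⟧)
    ≡⟨ ∑ᵥ-cong n (λ c → trans (cong ⟦_⟧ (does-⇔ (isProper⇔compatible G c) (isProper? G c) (compatible? F c)))
                              (sym (*-identityʳ _))) ⟩
  ∑ᵥ {q} n (λ c → ⟦ does (compatible? F c) ⟧ * 1ℤ)
    ≡⟨ ∑ᵥ-compatible n q F-sym Δ-free (λ _ → 1ℤ) ⟩
  matchingSum n F (λ i → falling (+ q) (n ∸ i) * 1ℤ)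
    ≡⟨ matchingSum-cong-≤ n F (λ {i} _ → *-identityʳ (falling (+ q) (n ∸ i))) ⟩
  matchingSum n F (λ i → falling (+ q) (n ∸ i)) ∎
  where
  F = adjᵇ (complement G)
  F-sym : Symmetricᵇ F
  F-sym u v = does-⇔ (mk⇔ (symm (complement G)) (symm (complement G))) (adj? (complement G) u v) (adj? (complement G) v u)

-- As S and its complement are cliques of G, all edges of the complement graph run between them: it
-- has no triangle, and S covers it. The resulting bound i ≤ j lets `n ∸ i` be written as k + (j -
-- i), the form from which (q)_k splits off.
biclique-#properColourings : (G : Graph n) {j k : ℕ} → IsBiclique j k G → ∀ q →
  + #properColourings G q ≡ ∑[ i ≤ j ] (+ #matchings (complement G) (toℕ i) * falling (+ q) (k ℕ.+ (j ∸ toℕ i)))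
biclique-#properColourings {n} G (S , refl , refl , S-clique , ∁S-clique) q = begin
  + #properColourings G q
    ≡⟨ #properColourings-matchingSum G Δ-free q ⟩
  matchingSum n F (λ i → falling (+ q) (n ∸ i))
    ≡⟨ matchingSum-cong-cover n F S cover (λ i≤ → cong (falling (+ q)) (reindex i≤)) ⟩
  matchingSum n F (λ i → falling (+ q) (∣ ∁ S ∣ ℕ.+ (∣ S ∣ ∸ i)))
    ≡⟨ matchingSum-δ n F S cover _ ⟩
  ∑[ i ≤ ∣ S ∣ ] (matchingSum n F (δ (toℕ i)) * falling (+ q) (∣ ∁ S ∣ ℕ.+ (∣ S ∣ ∸ toℕ i)))
    ≡⟨ (sum-cong-≗ {suc ∣ S ∣} λ i → cong (_* falling (+ q) (∣ ∁ S ∣ ℕ.+ (∣ S ∣ ∸ toℕ i))) (sym (#matchings-matchingSum (complement G) (toℕ i)))) ⟩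
  ∑[ i ≤ ∣ S ∣ ] (+ #matchings (complement G) (toℕ i) * falling (+ q) (∣ ∁ S ∣ ℕ.+ (∣ S ∣ ∸ toℕ i))) ∎
  where
  F = adjᵇ (complement G)
  nonadjacent : ∀ u v → F u v ≡ true → u ≢ v × ¬ Adj G u v
  nonadjacent u v = does⇒ (adj? (complement G) u v)
  not-both-in : ∀ u v → F u v ≡ true → u ∈ S → v ∈ S → ⊥
  not-both-in u v uv u∈S v∈S with u≢v , ¬uv ← nonadjacent u v uv = ¬uv (S-clique u v u∈S v∈S u≢v)
  cover : Cover F S
  cover u v uv with u ∈? S | v ∈? S
  ... | yes u∈S | _       = inj₁ u∈S
  ... | no  _   | yes v∈S = inj₂ v∈S
  ... | no  u∉S | no  v∉S with u≢v , ¬uv ← nonadjacent u v uv =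
    contradiction (∁S-clique u v (x∉p⇒x∈∁p u∉S) (x∉p⇒x∈∁p v∉S) u≢v) ¬uv
  -- To cover all three pairs, S must contain both ends of one of them, but no edge of F lies inside
  -- S.
  Δ-free : TriangleFree F
  Δ-free u v w uv uw vw with cover u v uv | cover u w uw | cover v w vw
  ... | inj₁ u∈S | inj₁ _   | inj₁ v∈S = not-both-in u v uv u∈S v∈S
  ... | inj₁ u∈S | inj₁ _   | inj₂ w∈S = not-both-in u w uw u∈S w∈S
  ... | inj₁ u∈S | inj₂ w∈S | _        = not-both-in u w uw u∈S w∈S
  ... | inj₂ v∈S | inj₁ u∈S | _        = not-both-in u v uv u∈S v∈S
  ... | inj₂ v∈S | inj₂ w∈S | _        = not-both-in v w vw v∈S w∈S
  reindex : ∀ {i} → i ≤ ∣ S ∣ → n ∸ i ≡ ∣ ∁ S ∣ ℕ.+ (∣ S ∣ ∸ i)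
  reindex {i} i≤ = trans
    (cong (_∸ i) (trans (sym (ℕ.m∸n+n≡m (∣p∣≤n S))) (cong (ℕ._+ ∣ S ∣) (sym (∣∁p∣≡n∸∣p∣ S)))))
    (ℕ.+-∸-assoc ∣ ∁ S ∣ i≤)

-- Polynomials and their values

eval-+ₚ : ∀ p q x → eval (p +ₚ q) x ≡ eval p x + eval q x
eval-+ₚ []      q       x = sym (+-identityˡ _)
eval-+ₚ (a ∷ p) []      x = sym (+-identityʳ _)
eval-+ₚ (a ∷ p) (b ∷ q) x = trans (cong (λ s → a + b + x * s) (eval-+ₚ p q x)) (interchange a b x (eval p x) (eval q x))
  where
  interchange : ∀ a b x p q → a + b + x * (p + q) ≡ a + x * p + (b + x * q)
  interchange = solve-∀

eval-·ₚ : ∀ a p x → eval (a ·ₚ p) x ≡ a * eval p x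
eval-·ₚ a []      x = sym (*-zeroʳ a)
eval-·ₚ a (b ∷ p) x = trans (cong (λ s → a * b + x * s) (eval-·ₚ a p x)) (distrib a b x (eval p x))
  where
  distrib : ∀ a b x p → a * b + x * (a * p) ≡ a * (b + x * p)
  distrib = solve-∀

eval-*ₚ : ∀ p q x → eval (p *ₚ q) x ≡ eval p x * eval q x
eval-*ₚ []      q x = refl
eval-*ₚ (a ∷ p) q x = begin
  eval ((a ·ₚ q) +ₚ (0ℤ ∷ (p *ₚ q))) x          ≡⟨ eval-+ₚ (a ·ₚ q) _ x ⟩
  eval (a ·ₚ q) x + (0ℤ + x * eval (p *ₚ q) x)  ≡⟨ cong₂ (λ s t → s + (0ℤ + x * t)) (eval-·ₚ a q x) (eval-*ₚ p q x) ⟩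
  a * eval q x + (0ℤ + x * (eval p x * eval q x)) ≡⟨ factor a x (eval p x) (eval q x) ⟩
  (a + x * eval p x) * eval q x                 ∎
  where
  factor : ∀ a x p q → a * q + (0ℤ + x * (p * q)) ≡ (a + x * p) * q
  factor = solve-∀

eval-∘ₚ : ∀ p r x → eval (p ∘ₚ r) x ≡ eval p (eval r x)
eval-∘ₚ []      r x = refl
eval-∘ₚ (a ∷ p) r x = begin
  eval ((a ∷ []) +ₚ r *ₚ (p ∘ₚ r)) x        ≡⟨ eval-+ₚ (a ∷ []) (r *ₚ (p ∘ₚ r)) x ⟩
  a + x * 0ℤ + eval (r *ₚ (p ∘ₚ r)) x       ≡⟨ cong₂ _+_ (trans (cong (λ s → a + s) (*-zeroʳ x)) (+-identityʳ a)) (eval-*ₚ r (p ∘ₚ r) x) ⟩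
  a + eval r x * eval (p ∘ₚ r) x            ≡⟨ cong (λ s → a + eval r x * s) (eval-∘ₚ p r x) ⟩
  a + eval r x * eval p (eval r x)          ∎

coeff-zero⇒eval-zero : ∀ p → (∀ n → coeff p n ≡ 0ℤ) → ∀ x → eval p x ≡ 0ℤ
coeff-zero⇒eval-zero []      p≈0 x = refl
coeff-zero⇒eval-zero (a ∷ p) p≈0 x =
  trans (cong₂ (λ s t → s + x * t) (p≈0 0) (coeff-zero⇒eval-zero p (p≈0 ∘ suc) x)) (trans (+-identityˡ (x * 0ℤ)) (*-zeroʳ x))

eval-cong : ∀ p q → p ≈ₚ q → ∀ x → eval p x ≡ eval q x
eval-cong []      q       p≈q x = sym (coeff-zero⇒eval-zero q (sym ∘ p≈q) x)
eval-cong (a ∷ p) []      p≈q x = coeff-zero⇒eval-zero (a ∷ p) p≈q x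
eval-cong (a ∷ p) (b ∷ q) p≈q x = cong₂ (λ s t → s + x * t) (p≈q 0) (eval-cong p q (p≈q ∘ suc) x)

-- A root x of a + x p(x) divides a, so a = 0 as soon as some root exceeds ∣a∣.
eventually-zero : ∀ p N → (∀ {q} → N ≤ q → eval p (+ q) ≡ 0ℤ) → ∀ n → coeff p n ≡ 0ℤ
eventually-zero []      N root n = refl
eventually-zero (a ∷ p) N root = λ where
    zero    → a≡0
    (suc n) → eventually-zero p (suc N) root-p n
  where
  M = ℤ.∣ a ∣ ℕ.+ N
  y = eval p (+ suc M)
  a≡-xy : a ≡ - (+ suc M * y)
  a≡-xy = i-j≡0⇒i≡j a (- (+ suc M * y)) (trans (cong (λ s → a + s) (neg-involutive (+ suc M * y))) (root (ℕ.m≤n⇒m≤1+n (ℕ.m≤n+m N ℤ.∣ a ∣))))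
  ∣a∣≡ : ℤ.∣ a ∣ ≡ suc M ℕ.* ℤ.∣ y ∣
  ∣a∣≡ = trans (cong ℤ.∣_∣ a≡-xy) (trans (∣-i∣≡∣i∣ (+ suc M * y)) (abs-* (+ suc M) y))
  multiple-small : ∀ b z → b ≤ M → b ≡ suc M ℕ.* z → b ≡ 0
  multiple-small zero    z b≤M _  = refl
  multiple-small (suc b) z b≤M eq = contradiction (subst (suc M ∣ℕ_) (sym eq) (m∣m*n z)) (>⇒∤ (s≤s b≤M))
  a≡0 : a ≡ 0ℤ
  a≡0 = ∣i∣≡0⇒i≡0 (multiple-small ℤ.∣ a ∣ ℤ.∣ y ∣ (ℕ.m≤m+n ℤ.∣ a ∣ N) ∣a∣≡)
  -- The bound grows from N to `suc N` so that q is positive and can be cancelled from q p(q) = 0.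
  root-p : ∀ {q} → suc N ≤ q → eval p (+ q) ≡ 0ℤ
  root-p {suc q} N<q = *-cancelˡ-≡ (+ suc q) (eval p (+ suc q)) 0ℤ (begin
    + suc q * eval p (+ suc q)      ≡⟨ sym (+-identityˡ _) ⟩
    0ℤ + + suc q * eval p (+ suc q) ≡⟨ cong (_+ + suc q * eval p (+ suc q)) a≡0 ⟨
    a + + suc q * eval p (+ suc q)  ≡⟨ root (ℕ.<⇒≤ N<q) ⟩
    0ℤ                              ≡⟨ *-zeroʳ (+ suc q) ⟨
    + suc q * 0ℤ                    ∎)

infixl 6 _-ₚ_
_-ₚ_ : Poly → Poly → Poly
p -ₚ q = p +ₚ (-1ℤ ·ₚ q)

eval--ₚ : ∀ p q x → eval (p -ₚ q) x ≡ eval p x - eval q x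
eval--ₚ p q x = trans (eval-+ₚ p (-1ℤ ·ₚ q) x) (cong (λ s → eval p x + s) (trans (eval-·ₚ -1ℤ q x) (-1*i≡-i (eval q x))))

coeff-+ₚ : ∀ p q n → coeff (p +ₚ q) n ≡ coeff p n + coeff q n
coeff-+ₚ []      q       n       = sym (+-identityˡ _)
coeff-+ₚ (a ∷ p) []      n       = sym (+-identityʳ _)
coeff-+ₚ (a ∷ p) (b ∷ q) zero    = refl
coeff-+ₚ (a ∷ p) (b ∷ q) (suc n) = coeff-+ₚ p q n

coeff-·ₚ : ∀ a p n → coeff (a ·ₚ p) n ≡ a * coeff p n
coeff-·ₚ a []      n       = sym (*-zeroʳ a)
coeff-·ₚ a (b ∷ p) zero    = refl
coeff-·ₚ a (b ∷ p) (suc n) = coeff-·ₚ a p n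

eventually-equal : ∀ p q N → (∀ {r} → N ≤ r → eval p (+ r) ≡ eval q (+ r)) → p ≈ₚ q
eventually-equal p q N eq n = i-j≡0⇒i≡j (coeff p n) (coeff q n) (begin
  coeff p n - coeff q n              ≡⟨ cong (λ s → coeff p n + s) (trans (coeff-·ₚ -1ℤ q n) (-1*i≡-i (coeff q n))) ⟨
  coeff p n + coeff (-1ℤ ·ₚ q) n     ≡⟨ coeff-+ₚ p (-1ℤ ·ₚ q) n ⟨
  coeff (p -ₚ q) n                   ≡⟨ eventually-zero (p -ₚ q) N (λ {r} N≤r →
                                          trans (eval--ₚ p q (+ r)) (i≡j⇒i-j≡0 (eq N≤r))) n ⟩
  0ℤ                                 ∎)

IsPolynomial : (ℤ → ℤ) → Set
IsPolynomial f = ∃ λ p → ∀ x → eval p x ≡ f x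

-- Carries a formula obtained at large natural numbers to all integers, in particular to the
-- arguments c - x at which h is needed and which may be negative.
polynomial-identity : ∀ {f f′} → IsPolynomial f → IsPolynomial f′ → ∀ N →
  (∀ {q} → N ≤ q → f (+ q) ≡ f′ (+ q)) → ∀ x → f x ≡ f′ x
polynomial-identity (p , p≗f) (p′ , p′≗f′) N eq x = begin
  _          ≡⟨ p≗f x ⟨
  eval p x   ≡⟨ eval-cong p p′ (eventually-equal p p′ N (λ {q} N≤q → trans (p≗f (+ q)) (trans (eq N≤q) (sym (p′≗f′ (+ q)))))) x ⟩
  eval p′ x  ≡⟨ p′≗f′ x ⟩
  _          ∎

eval-linear : ∀ a b x → eval (a ∷ b ∷ []) x ≡ a + x * b
eval-linear a b x = cong (λ s → a + x * s) (trans (cong (λ s → b + s) (*-zeroʳ x)) (+-identityʳ b))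

eval-fallingₚ : ∀ n x → eval (fallingₚ n) x ≡ falling x n
eval-fallingₚ zero    x = trans (cong (λ s → 1ℤ + s) (*-zeroʳ x)) (+-identityʳ 1ℤ)
eval-fallingₚ (suc n) x = trans (eval-*ₚ (fallingₚ n) _ x)
  (cong₂ _*_ (eval-fallingₚ n x) (trans (eval-linear (- + n) 1ℤ x) (trans (cong (λ s → - + n + s) (*-identityʳ x)) (+-comm (- + n) x))))

falling-polynomial : ∀ k n → IsPolynomial (λ x → falling (x - k) n)
falling-polynomial k n = fallingₚ n ∘ₚ (- k ∷ 1ℤ ∷ []) , λ x →
  trans (eval-∘ₚ (fallingₚ n) (- k ∷ 1ℤ ∷ []) x) (trans (eval-fallingₚ n _)
  (cong (λ y → falling y n) (trans (eval-linear (- k) 1ℤ x) (trans (cong (λ s → - k + s) (*-identityʳ x)) (+-comm (- k) x)))))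

∑-polynomial : ∀ {n} (a : Fin n → ℤ) {f : Fin n → ℤ → ℤ} → (∀ i → IsPolynomial (f i)) →
  IsPolynomial (λ x → ∑[ i < n ] (a i * f i x))
∑-polynomial {zero}  a poly = [] , λ _ → refl
∑-polynomial {suc n} a poly with p , p≗ ← poly zero | r , r≗ ← ∑-polynomial (a ∘ suc) (poly ∘ suc) =
  (a zero ·ₚ p) +ₚ r , λ x → trans (eval-+ₚ (a zero ·ₚ p) r x)
    (cong₂ _+_ (trans (eval-·ₚ (a zero) p x) (cong (a zero *_) (p≗ x))) (r≗ x))

-- Sums over initial segments of ℕ

∑-cong-≤ : ∀ n {f g : ℕ → ℤ} → (∀ {i} → i ≤ n → f i ≡ g i) → ∑[ i ≤ n ] f (toℕ i) ≡ ∑[ i ≤ n ] g (toℕ i)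
∑-cong-≤ n eq = sum-cong-≗ {suc n} λ i → eq (toℕ≤pred[n] i)

∑-last : ∀ n (f : ℕ → ℤ) → ∑[ i ≤ suc n ] f (toℕ i) ≡ ∑[ i ≤ n ] f (toℕ i) + f (suc n)
∑-last zero    f = rearrange (f 0) (f 1)
  where
  rearrange : ∀ a b → a + (b + 0ℤ) ≡ a + 0ℤ + b
  rearrange = solve-∀
∑-last (suc n) f = trans (cong (λ s → f 0 + s) (∑-last n (f ∘ suc))) (sym (+-assoc (f 0) _ _))

∑-reverse : ∀ n (f : ℕ → ℤ) → ∑[ i ≤ n ] f (toℕ i) ≡ ∑[ i ≤ n ] f (n ∸ toℕ i)
∑-reverse n f = trans (∑-permute {suc n} (f ∘ toℕ) reverse) (sum-cong-≗ {suc n} λ i → cong f (opposite-prop i))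

-- Both sides run over the pairs l ≤ i ≤ n, with i = l + r on the right; the induction peels off the
-- pairs with l = 0.
∑-triangle : ∀ n (f : ℕ → ℕ → ℤ) →
  ∑[ i ≤ n ] ∑[ l ≤ toℕ i ] f (toℕ l) (toℕ i) ≡ ∑[ l ≤ n ] ∑[ r ≤ n ∸ toℕ l ] f (toℕ l) (toℕ l ℕ.+ toℕ r)
∑-triangle zero    f = refl
∑-triangle (suc n) f = begin
  f 0 0 + 0ℤ + ∑[ i ≤ n ] (f 0 (suc (toℕ i)) + ∑[ l ≤ toℕ i ] f (suc (toℕ l)) (suc (toℕ i)))
    ≡⟨ cong₂ _+_ (+-identityʳ (f 0 0)) (∑-distrib-+ {suc n} (λ i → f 0 (suc (toℕ i)))
         (λ i → ∑[ l ≤ toℕ i ] f (suc (toℕ l)) (suc (toℕ i)))) ⟩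
  f 0 0 + (∑[ i ≤ n ] f 0 (suc (toℕ i)) + ∑[ i ≤ n ] ∑[ l ≤ toℕ i ] f (suc (toℕ l)) (suc (toℕ i)))
    ≡⟨ cong (λ s → f 0 0 + (∑[ i ≤ n ] f 0 (suc (toℕ i)) + s)) (∑-triangle n (λ l i → f (suc l) (suc i))) ⟩
  f 0 0 + (∑[ i ≤ n ] f 0 (suc (toℕ i)) + _)
    ≡⟨ +-assoc (f 0 0) _ _ ⟨
  ∑[ l ≤ suc n ] ∑[ r ≤ suc n ∸ toℕ l ] f (toℕ l) (toℕ l ℕ.+ toℕ r) ∎

-- Falling factorials

falling-+ : ∀ x k n → falling x (k ℕ.+ n) ≡ falling x k * falling (x - + k) n
falling-+ x k zero    = trans (cong (falling x) (ℕ.+-identityʳ k)) (sym (*-identityʳ _))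
falling-+ x k (suc n) = begin
  falling x (k ℕ.+ suc n)                                 ≡⟨ cong (falling x) (ℕ.+-suc k n) ⟩
  falling x (k ℕ.+ n) * (x - + (k ℕ.+ n))                 ≡⟨ cong₂ (λ s t → s * (x - t)) (falling-+ x k n) (pos-+ k n) ⟩
  falling x k * falling (x - + k) n * (x - (+ k + + n))   ≡⟨ assoc (falling x k) (falling (x - + k) n) x (+ k) (+ n) ⟩
  falling x k * (falling (x - + k) n * (x - + k - + n))   ∎
  where
  assoc : ∀ a b x k n → a * b * (x - (k + n)) ≡ a * (b * (x - k - n))
  assoc = solve-∀

falling-suc : ∀ x n → falling x (suc n) ≡ x * falling (x - 1ℤ) n
falling-suc x n = trans (falling-+ x 1 n) (cong (_* falling (x - 1ℤ) n) (unit x))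
  where
  unit : ∀ x → 1ℤ * (x - 0ℤ) ≡ x
  unit = solve-∀

falling-≢0 : ∀ {k q} → k ≤ q → falling (+ q) k ≢ 0ℤ
falling-≢0 z≤n ()
falling-≢0 {suc k} {suc q} (s≤s k≤q) eq = falling-≢0 k≤q
  (*-cancelˡ-≡ (+ suc q) _ 0ℤ (trans (sym (falling-suc (+ suc q) k)) (trans eq (sym (*-zeroʳ (+ suc q))))))

-- Up to sign, the factors -y, -y - 1, ... are y, y + 1, ..., y + n - 1, which is a falling
-- factorial read from its last factor.
falling-neg : ∀ y n → falling (- y) n ≡ -1ℤ ^ n * falling (y + + n - 1ℤ) n
falling-neg y zero    = refl
falling-neg y (suc n) = begin
  falling (- y) n * (- y - + n)                             ≡⟨ cong (_* (- y - + n)) (falling-neg y n) ⟩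
  -1ℤ ^ n * falling (y + + n - 1ℤ) n * (- y - + n)          ≡⟨ sign (-1ℤ ^ n) (falling (y + + n - 1ℤ) n) y (+ n) ⟩
  -1ℤ * -1ℤ ^ n * ((y + + n) * falling (y + + n - 1ℤ) n)    ≡⟨ cong (-1ℤ * -1ℤ ^ n *_) (falling-suc (y + + n) n) ⟨
  -1ℤ * -1ℤ ^ n * falling (y + + n) (suc n)                 ≡⟨ cong (λ z → -1ℤ * -1ℤ ^ n * falling z (suc n)) (lower y (+ n)) ⟩
  -1ℤ ^ suc n * falling (y + + suc n - 1ℤ) (suc n)          ∎
  where
  sign : ∀ s f y n → s * f * (- y - n) ≡ -1ℤ * s * ((y + n) * f)
  sign = solve-∀
  lower : ∀ y n → y + n ≡ y + (1ℤ + n) - 1ℤ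
  lower = solve-∀

vandermonde : ∀ x y n →
  falling (x + y) n ≡ ∑[ r ≤ n ] (+ (n C toℕ r) * (falling x (n ∸ toℕ r) * falling y (toℕ r)))
vandermonde x y zero    = refl
vandermonde x y (suc n) = begin
  falling (x + y) n * (x + y - + n)
    ≡⟨ cong (_* (x + y - + n)) (vandermonde x y n) ⟩
  (∑[ r ≤ n ] (binom (toℕ r) * (X (n ∸ toℕ r) * Y (toℕ r)))) * (x + y - + n)
    ≡⟨ *-distribʳ-sum {suc n} (x + y - + n) (λ r → binom (toℕ r) * (X (n ∸ toℕ r) * Y (toℕ r))) ⟩
  ∑[ r ≤ n ] (binom (toℕ r) * (X (n ∸ toℕ r) * Y (toℕ r)) * (x + y - + n))
    ≡⟨ ∑-cong-≤ n split ⟩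
  ∑[ r ≤ n ] (U (toℕ r) + V (toℕ r))
    ≡⟨ ∑-distrib-+ {suc n} (U ∘ toℕ) (V ∘ toℕ) ⟩
  ∑[ r ≤ n ] U (toℕ r) + ∑[ r ≤ n ] V (toℕ r)
    ≡⟨ cong (_+ ∑[ r ≤ n ] V (toℕ r)) (sym extend) ⟩
  U 0 + ∑[ r ≤ n ] U (suc (toℕ r)) + ∑[ r ≤ n ] V (toℕ r)
    ≡⟨ +-assoc (U 0) _ _ ⟩
  U 0 + (∑[ r ≤ n ] U (suc (toℕ r)) + ∑[ r ≤ n ] V (toℕ r))
    ≡⟨ cong (λ s → U 0 + s) (trans (sym (∑-distrib-+ {suc n} (U ∘ suc ∘ toℕ) (V ∘ toℕ))) (sum-cong-≗ {suc n} λ r → pascal (toℕ r))) ⟩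
  ∑[ r ≤ suc n ] (+ (suc n C toℕ r) * (X (suc n ∸ toℕ r) * Y (toℕ r))) ∎
  where
  X Y U V binom : ℕ → ℤ
  X = falling x
  Y = falling y
  binom r = + (n C r)
  U r = binom r * (X (suc n ∸ r) * Y r)
  V r = binom r * (X (n ∸ r) * Y (suc r))
  -- The new factor x + y - n is (x - (n - r)) + (y - r), and each part extends one of the two
  -- falling factorials.
  split : ∀ {r} → r ≤ n → binom r * (X (n ∸ r) * Y r) * (x + y - + n) ≡ U r + V r
  split {r} r≤n rewrite ℕ.+-∸-assoc 1 r≤n = trans
    (cong (λ m → binom r * (X (n ∸ r) * Y r) * (x + y - m)) (trans (cong +_ (sym (ℕ.m∸n+n≡m r≤n))) (pos-+ (n ∸ r) r)))
    (ring (binom r) (X (n ∸ r)) (Y r) x y (+ (n ∸ r)) (+ r))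
    where
    ring : ∀ c a b x y m r → c * (a * b) * (x + y - (m + r)) ≡ c * (a * (x - m) * b) + c * (a * (b * (y - r)))
    ring = solve-∀
  -- The term added at r = n + 1 vanishes with its binomial; it lines the two sums up for Pascal's
  -- rule.
  extend : ∑[ r ≤ suc n ] U (toℕ r) ≡ ∑[ r ≤ n ] U (toℕ r)
  extend = trans (∑-last n U) (trans
    (cong (λ c → ∑[ r ≤ n ] U (toℕ r) + + c * (X (n ∸ n) * Y (suc n))) (k>n⇒nCk≡0 (ℕ.n<1+n n)))
    (+-identityʳ _))
  pascal : ∀ r → U (suc r) + V r ≡ + (suc n C suc r) * (X (n ∸ r) * Y (suc r))
  pascal r = trans (sym (*-distribʳ-+ (X (n ∸ r) * Y (suc r)) (binom (suc r)) (binom r)))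
    (cong (_* (X (n ∸ r) * Y (suc r))) (cong +_ (trans (ℕ.+-comm (n C suc r) (n C r)) (nCk+nC[k+1]≡[n+1]C[k+1] n r))))

-- At r = 0 only the term i = 0 survives. Once it is removed, the other terms at r + 1 share the
-- factor r + 1; cancelling it leaves the same equations for the shifted coefficients.
falling-independent : ∀ n (d e : ℕ → ℤ) →
  (∀ r → ∑[ i ≤ n ] (d (toℕ i) * falling (+ r) (toℕ i)) ≡ ∑[ i ≤ n ] (e (toℕ i) * falling (+ r) (toℕ i))) →
  ∀ {i} → i ≤ n → d i ≡ e i
falling-independent n d e eq {zero} _ = trans (sym (at-0 d)) (trans (eq 0) (at-0 e))
  where
  at-0 : ∀ d → ∑[ i ≤ n ] (d (toℕ i) * falling (+ 0) (toℕ i)) ≡ d 0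
  at-0 d = trans (cong₂ _+_ (*-identityʳ (d 0)) (sum-zero {n} λ i →
    trans (cong (d (suc (toℕ i)) *_) (falling-suc (+ 0) (toℕ i))) (*-zeroʳ (d (suc (toℕ i)))))) (+-identityʳ (d 0))
falling-independent (suc n) d e eq {suc i} (s≤s i≤n) = falling-independent n (d ∘ suc) (e ∘ suc) eq′ i≤n
  where
  pull : ∀ r (d : ℕ → ℤ) → ∑[ i ≤ n ] (d (suc (toℕ i)) * falling (+ suc r) (suc (toℕ i))) ≡
                   + suc r * ∑[ i ≤ n ] (d (suc (toℕ i)) * falling (+ r) (toℕ i))
  pull r d = trans
    (sum-cong-≗ {suc n} λ i → trans (cong (d (suc (toℕ i)) *_) (falling-suc (+ suc r) (toℕ i))) (x*yz≡y*xz (d (suc (toℕ i))) (+ suc r) _))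
    (sym (*-distribˡ-sum {suc n} (+ suc r) (λ i → d (suc (toℕ i)) * falling (+ r) (toℕ i))))
  d₀≡e₀ : d 0 ≡ e 0
  d₀≡e₀ = falling-independent (suc n) d e eq z≤n
  eq′ : ∀ r → ∑[ i ≤ n ] (d (suc (toℕ i)) * falling (+ r) (toℕ i)) ≡ ∑[ i ≤ n ] (e (suc (toℕ i)) * falling (+ r) (toℕ i))
  eq′ r = *-cancelˡ-≡ (+ suc r) _ _ (trans (sym (pull r d)) (trans
    (∙-cancelˡ (d 0 * 1ℤ) _ _ (trans (eq (suc r)) (cong (λ y → y * 1ℤ + ∑[ i ≤ n ] (e (suc (toℕ i)) * falling (+ suc r) (suc (toℕ i)))) (sym d₀≡e₀))))
    (pull r e)))

falling-independent-reversed : ∀ n (d e : ℕ → ℤ) →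
  (∀ r → ∑[ i ≤ n ] (d (toℕ i) * falling (+ r) (n ∸ toℕ i)) ≡ ∑[ i ≤ n ] (e (toℕ i) * falling (+ r) (n ∸ toℕ i))) →
  ∀ {i} → i ≤ n → d i ≡ e i
falling-independent-reversed n d e eq {i} i≤n =
  subst (λ k → d k ≡ e k) (ℕ.m∸[m∸n]≡n i≤n)
    (falling-independent n (λ k → d (n ∸ k)) (λ k → e (n ∸ k))
      (λ r → trans (sym (reversed d r)) (trans (eq r) (reversed e r))) (ℕ.m∸n≤m n i))
  where
  reversed : ∀ (d : ℕ → ℤ) r → ∑[ i ≤ n ] (d (toℕ i) * falling (+ r) (n ∸ toℕ i)) ≡ ∑[ i ≤ n ] (d (n ∸ toℕ i) * falling (+ r) (toℕ i))
  reversed d r = trans (∑-reverse n (λ k → d k * falling (+ r) (n ∸ k)))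
    (∑-cong-≤ n λ {k} k≤n → cong (λ m → d (n ∸ k) * falling (+ r) m) (ℕ.m∸[m∸n]≡n k≤n))

-- The interesting factor and its reflection

interestingFactor : ∀ {j k} (G : Graph n) → IsBiclique j k G → ∀ P g →
  IsChromaticPolynomial G P → P ≈ₚ fallingₚ k *ₚ g → ∀ x →
  eval g x ≡ ∑[ i ≤ j ] (+ #matchings (complement G) (toℕ i) * falling (x - + k) (j ∸ toℕ i))
interestingFactor {j = j} {k} G biclique P g chromatic P≈ =
  polynomial-identity (g , λ _ → refl) (∑-polynomial {suc j} m (λ i → falling-polynomial (+ k) (j ∸ toℕ i))) k large
  where
  m : Fin (suc j) → ℤ
  m i = + #matchings (complement G) (toℕ i)
  large : ∀ {q} → k ≤ q → eval g (+ q) ≡ ∑[ i ≤ j ] (m i * falling (+ q - + k) (j ∸ toℕ i))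
  -- For q at least k all factors of (q)_k are positive, so it can be cancelled from the two
  -- expressions for P_G(q).
  large {q} k≤q = *-cancelˡ-≡ (falling (+ q) k) _ _ {{≢-nonZero (falling-≢0 k≤q)}} (begin
    falling (+ q) k * eval g (+ q)            ≡⟨ cong (_* eval g (+ q)) (eval-fallingₚ k (+ q)) ⟨
    eval (fallingₚ k) (+ q) * eval g (+ q)    ≡⟨ eval-*ₚ (fallingₚ k) g (+ q) ⟨
    eval (fallingₚ k *ₚ g) (+ q)              ≡⟨ eval-cong P (fallingₚ k *ₚ g) P≈ (+ q) ⟨
    eval P (+ q)                              ≡⟨ chromatic q ⟩
    + #properColourings G q                   ≡⟨ biclique-#properColourings G biclique q ⟩
    ∑[ i ≤ j ] (m i * falling (+ q) (k ℕ.+ (j ∸ toℕ i)))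
      ≡⟨ (sum-cong-≗ {suc j} λ i → trans (cong (m i *_) (falling-+ (+ q) k (j ∸ toℕ i))) (x*yz≡y*xz (m i) (falling (+ q) k) _)) ⟩
    ∑[ i ≤ j ] (falling (+ q) k * (m i * falling (+ q - + k) (j ∸ toℕ i)))
      ≡⟨ *-distribˡ-sum {suc j} (falling (+ q) k) (λ i → m i * falling (+ q - + k) (j ∸ toℕ i)) ⟨
    falling (+ q) k * ∑[ i ≤ j ] (m i * falling (+ q - + k) (j ∸ toℕ i)) ∎)

-1^-square : ∀ n → -1ℤ ^ n * -1ℤ ^ n ≡ 1ℤ
-1^-square zero    = refl
-1^-square (suc n) = trans (square (-1ℤ ^ n)) (-1^-square n)
  where
  square : ∀ s → -1ℤ * s * (-1ℤ * s) ≡ s * s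
  square = solve-∀

-- Of the sign (-1)^j, the part (-1)^(j - l) cancels the sign from `falling-neg`. What is left is
-- the (-1)^l of the theorem.
falling-reflect : ∀ y {j l} → l ≤ j →
  -1ℤ ^ j * falling (- y) (j ∸ l) ≡ -1ℤ ^ l * falling (y + (+ j - + l) - 1ℤ) (j ∸ l)
falling-reflect y {j} {l} l≤j = begin
  -1ℤ ^ j * falling (- y) d                                ≡⟨ cong₂ _*_ (trans (cong (-1ℤ ^_) (sym d+l≡j)) (^-distribˡ-+-* -1ℤ d l)) (falling-neg y d) ⟩
  -1ℤ ^ d * -1ℤ ^ l * (-1ℤ ^ d * falling (y + + d - 1ℤ) d) ≡⟨ gather (-1ℤ ^ d) (-1ℤ ^ l) _ ⟩
  -1ℤ ^ d * -1ℤ ^ d * (-1ℤ ^ l * falling (y + + d - 1ℤ) d) ≡⟨ cong (_* (-1ℤ ^ l * falling (y + + d - 1ℤ) d)) (-1^-square d) ⟩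
  1ℤ * (-1ℤ ^ l * falling (y + + d - 1ℤ) d)                ≡⟨ *-identityˡ _ ⟩
  -1ℤ ^ l * falling (y + + d - 1ℤ) d                       ≡⟨ cong (λ z → -1ℤ ^ l * falling (y + z - 1ℤ) d) +d≡ ⟩
  -1ℤ ^ l * falling (y + (+ j - + l) - 1ℤ) d               ∎
  where
  d = j ∸ l
  d+l≡j : d ℕ.+ l ≡ j
  d+l≡j = ℕ.m∸n+n≡m l≤j
  gather : ∀ a b f → a * b * (a * f) ≡ a * a * (b * f)
  gather = solve-∀
  cancel : ∀ a b → a ≡ a + b - b
  cancel = solve-∀
  +d≡ : + d ≡ + j - + l
  +d≡ = trans (cancel (+ d) (+ l)) (cong (_- + l) (trans (sym (pos-+ d l)) (cong +_ d+l≡j)))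

-- The shift N may vary with l, yet Vandermonde expands every term in the common basis of falling
-- factorials of x; the terms are then collected by i = l + r.
∑-vandermonde : ∀ j x (a N : ℕ → ℤ) →
  ∑[ l ≤ j ] (a (toℕ l) * falling (x + N (toℕ l)) (j ∸ toℕ l)) ≡
  ∑[ i ≤ j ] ((∑[ l ≤ toℕ i ] (a (toℕ l) * + ((j ∸ toℕ l) C (j ∸ toℕ i)) * falling (N (toℕ l)) (toℕ i ∸ toℕ l)))
              * falling x (j ∸ toℕ i))
∑-vandermonde j x a N = begin
  ∑[ l ≤ j ] (a (toℕ l) * falling (x + N (toℕ l)) (j ∸ toℕ l))
    ≡⟨ ∑-cong-≤ j expand ⟩
  ∑[ l ≤ j ] ∑[ r ≤ j ∸ toℕ l ] term (toℕ l) (toℕ l ℕ.+ toℕ r)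
    ≡⟨ ∑-triangle j term ⟨
  ∑[ i ≤ j ] ∑[ l ≤ toℕ i ] term (toℕ l) (toℕ i)
    ≡⟨ (sum-cong-≗ {suc j} λ i → sym (*-distribʳ-sum {suc (toℕ i)} (falling x (j ∸ toℕ i)) (λ l → coefficient (toℕ l) (toℕ i)))) ⟩
  ∑[ i ≤ j ] ((∑[ l ≤ toℕ i ] coefficient (toℕ l) (toℕ i)) * falling x (j ∸ toℕ i)) ∎
  where
  coefficient term : ℕ → ℕ → ℤ
  coefficient l i = a l * + ((j ∸ l) C (j ∸ i)) * falling (N l) (i ∸ l)
  term l i = coefficient l i * falling x (j ∸ i)
  expand : ∀ {l} → l ≤ j → a l * falling (x + N l) (j ∸ l) ≡ ∑[ r ≤ j ∸ l ] term l (l ℕ.+ toℕ r)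
  expand {l} _ = begin
    a l * falling (x + N l) (j ∸ l)
      ≡⟨ cong (a l *_) (vandermonde x (N l) (j ∸ l)) ⟩
    a l * ∑[ r ≤ j ∸ l ] summand (toℕ r)
      ≡⟨ *-distribˡ-sum {suc (j ∸ l)} (a l) (λ r → summand (toℕ r)) ⟩
    ∑[ r ≤ j ∸ l ] (a l * summand (toℕ r))
      ≡⟨ ∑-cong-≤ (j ∸ l) reindex ⟩
    ∑[ r ≤ j ∸ l ] term l (l ℕ.+ toℕ r) ∎
    where
    summand : ℕ → ℤ
    summand r = + ((j ∸ l) C r) * (falling x (j ∸ l ∸ r) * falling (N l) r)
    regroup : ∀ a c f g → a * (c * (f * g)) ≡ a * c * g * f
    regroup = solve-∀
    reindex : ∀ {r} → r ≤ j ∸ l → a l * summand r ≡ term l (l ℕ.+ r)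
    -- With i = l + r, the symmetry of the binomial turns `(j ∸ l) C r` into `(j ∸ l) C (j ∸ i)`.
    reindex {r} r≤ rewrite ℕ.m+n∸m≡n l r | sym (ℕ.∸-+-assoc j l r) | nCk≡nC[n∸k] r≤ =
      regroup (a l) (+ ((j ∸ l) C (j ∸ l ∸ r))) (falling x (j ∸ l ∸ r)) (falling (N l) r)

mainTheorem3 : ∀ {nG nH : ℕ} (j kG kH : ℕ) →
    1 ≤ j → 1 ≤ kG → 1 ≤ kH → j ≤ kG → kG ≤ kH →
    (G : Graph nG) (H : Graph nH) →
    IsBiclique j kG G → IsBiclique j kH H →
    (PG PH g h : Poly) →
    IsChromaticPolynomial G PG → IsChromaticPolynomial H PH →
    PG ≈ₚ fallingₚ kG *ₚ g → PH ≈ₚ fallingₚ kH *ₚ h →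
    (c : ℤ) →
    g ≈ₚ (-1ℤ ^ j) ·ₚ (h ∘ₚ (-X+ c))
    ⇔
    (∀ i → i ≤ j →
    + #matchings (complement G) i
    ≡
    ∑[ l ≤ i ]
    ((-1ℤ ^ toℕ l) * + #matchings (complement H) (toℕ l)
    * + ((j ∸ toℕ l) C (j ∸ i))
    * falling (+ kG + + kH + + j - c - + toℕ l - + 1) (i ∸ toℕ l)))
mainTheorem3 j kG kH _ _ _ _ _ G H G-biclique H-biclique PG PH g h PG-chromatic PH-chromatic PG≈ PH≈ c =
  mk⇔ to from
  where
  mG mH N R : ℕ → ℤ
  mG i = + #matchings (complement G) i
  mH l = + #matchings (complement H) l
  -- Reflecting the falling factorial at c - x - kH gives the argument x - c + kH + j - l - 1; `N l`
  -- is its excess over x - kG.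
  N l = + kG + + kH + + j - c - + l - + 1
  R i = ∑[ l ≤ i ] ((-1ℤ ^ toℕ l) * mH (toℕ l) * + ((j ∸ toℕ l) C (j ∸ i)) * falling (N (toℕ l)) (i ∸ toℕ l))

  h⁻ : Poly
  h⁻ = (-1ℤ ^ j) ·ₚ (h ∘ₚ (-X+ c))

  eval-g : ∀ x → eval g x ≡ ∑[ i ≤ j ] (mG (toℕ i) * falling (x - + kG) (j ∸ toℕ i))
  eval-g = interestingFactor G G-biclique PG g PG-chromatic PG≈

  eval-h⁻ : ∀ x → eval h⁻ x ≡ ∑[ i ≤ j ] (R (toℕ i) * falling (x - + kG) (j ∸ toℕ i))
  eval-h⁻ x = begin
    eval h⁻ x
      ≡⟨ eval-·ₚ (-1ℤ ^ j) (h ∘ₚ (-X+ c)) x ⟩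
    -1ℤ ^ j * eval (h ∘ₚ (-X+ c)) x
      ≡⟨ cong (-1ℤ ^ j *_) (trans (eval-∘ₚ h (-X+ c) x) (interestingFactor H H-biclique PH h PH-chromatic PH≈ (eval (-X+ c) x))) ⟩
    -1ℤ ^ j * ∑[ l ≤ j ] (mH (toℕ l) * falling (eval (-X+ c) x - + kH) (j ∸ toℕ l))
      ≡⟨ *-distribˡ-sum {suc j} (-1ℤ ^ j) (λ l → mH (toℕ l) * falling (eval (-X+ c) x - + kH) (j ∸ toℕ l)) ⟩
    ∑[ l ≤ j ] (-1ℤ ^ j * (mH (toℕ l) * falling (eval (-X+ c) x - + kH) (j ∸ toℕ l)))
      ≡⟨ ∑-cong-≤ j reflect ⟩
    ∑[ l ≤ j ] (-1ℤ ^ toℕ l * mH (toℕ l) * falling (x - + kG + N (toℕ l)) (j ∸ toℕ l))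
      ≡⟨ ∑-vandermonde j (x - + kG) (λ l → -1ℤ ^ l * mH l) N ⟩
    ∑[ i ≤ j ] (R (toℕ i) * falling (x - + kG) (j ∸ toℕ i)) ∎
    where
    y = x - c + + kH
    negated : ∀ x c k → c + x * -1ℤ - k ≡ - (x - c + k)
    negated = solve-∀
    shifted : ∀ x c k k′ j l → x - c + k′ + (j - l) - 1ℤ ≡ x - k + (k + k′ + j - c - l - 1ℤ)
    shifted = solve-∀
    reassoc : ∀ x y z → y * (x * z) ≡ x * y * z
    reassoc = solve-∀
    reflect : ∀ {l} → l ≤ j → -1ℤ ^ j * (mH l * falling (eval (-X+ c) x - + kH) (j ∸ l)) ≡
                              -1ℤ ^ l * mH l * falling (x - + kG + N l) (j ∸ l)
    reflect {l} l≤j = begin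
      -1ℤ ^ j * (mH l * falling (eval (-X+ c) x - + kH) (j ∸ l))
        ≡⟨ x*yz≡y*xz (-1ℤ ^ j) (mH l) _ ⟩
      mH l * (-1ℤ ^ j * falling (eval (-X+ c) x - + kH) (j ∸ l))
        ≡⟨ cong (λ z → mH l * (-1ℤ ^ j * falling z (j ∸ l))) (trans (cong (_- + kH) (eval-linear c -1ℤ x)) (negated x c (+ kH))) ⟩
      mH l * (-1ℤ ^ j * falling (- y) (j ∸ l))
        ≡⟨ cong (mH l *_) (falling-reflect y l≤j) ⟩
      mH l * (-1ℤ ^ l * falling (y + (+ j - + l) - 1ℤ) (j ∸ l))
        ≡⟨ cong (λ z → mH l * (-1ℤ ^ l * falling z (j ∸ l))) (shifted x c (+ kG) (+ kH) (+ j) (+ l)) ⟩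
      mH l * (-1ℤ ^ l * falling (x - + kG + N l) (j ∸ l))
        ≡⟨ reassoc (-1ℤ ^ l) (mH l) _ ⟩
      -1ℤ ^ l * mH l * falling (x - + kG + N l) (j ∸ l) ∎

  to : g ≈ₚ h⁻ → ∀ i → i ≤ j → mG i ≡ R i
  to g≈h⁻ i = falling-independent-reversed j mG R λ r → begin
    ∑[ i ≤ j ] (mG (toℕ i) * falling (+ r) (j ∸ toℕ i))       ≡⟨ at r mG ⟨
    ∑[ i ≤ j ] (mG (toℕ i) * falling (x r - + kG) (j ∸ toℕ i)) ≡⟨ eval-g (x r) ⟨
    eval g (x r)                                              ≡⟨ eval-cong g h⁻ g≈h⁻ (x r) ⟩
    eval h⁻ (x r)                                             ≡⟨ eval-h⁻ (x r) ⟩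
    ∑[ i ≤ j ] (R (toℕ i) * falling (x r - + kG) (j ∸ toℕ i)) ≡⟨ at r R ⟩
    ∑[ i ≤ j ] (R (toℕ i) * falling (+ r) (j ∸ toℕ i))        ∎
    where
    x : ℕ → ℤ
    -- At r + kG the shifted basis becomes the plain falling factorials of r, to which independence
    -- applies.
    x r = + r + + kG
    cancel : ∀ a b → a + b - b ≡ a
    cancel = solve-∀
    at : ∀ r (d : ℕ → ℤ) → ∑[ i ≤ j ] (d (toℕ i) * falling (x r - + kG) (j ∸ toℕ i)) ≡ ∑[ i ≤ j ] (d (toℕ i) * falling (+ r) (j ∸ toℕ i))
    at r d = cong (λ z → ∑[ i ≤ j ] (d (toℕ i) * falling z (j ∸ toℕ i))) (cancel (+ r) (+ kG))

  from : (∀ i → i ≤ j → mG i ≡ R i) → g ≈ₚ h⁻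
  from mG≡R = eventually-equal g h⁻ 0 λ {r} _ → begin
    eval g (+ r)                                                  ≡⟨ eval-g (+ r) ⟩
    ∑[ i ≤ j ] (mG (toℕ i) * falling (+ r - + kG) (j ∸ toℕ i))    ≡⟨ ∑-cong-≤ j (λ {i} i≤j → cong (_* falling (+ r - + kG) (j ∸ i)) (mG≡R i i≤j)) ⟩
    ∑[ i ≤ j ] (R (toℕ i) * falling (+ r - + kG) (j ∸ toℕ i))     ≡⟨ eval-h⁻ (+ r) ⟨
    eval h⁻ (+ r)                                                 ∎
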